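{- Let $q$ be an odd prime power, let $e\geq 2$, and let $R$ be a symplectic spread of $Sp(2e,q)$. Partition the vertices of $Sp(2e,q)$ into two parts $V_1$ and $V_2$ of equal size such that each part contains (is the union of) $(q^e+1)/2$ cliques of the spread. Let $\Gamma'_{q,e,R}$ be the graph obtained from $Sp(2e,q)$ by replacing the subgraphs induced by $V_1$ and by $V_2$ by their complements (keeping the edges between $V_1$ and $V_2$ unchanged). Then, with $v=\frac{q^{2e}-1}{q-1}$, the graph $\Gamma'_{q,e,R}$ is a divisible design graph with parameters $$(v,k,\lambda_1,\lambda_2,m,n)=\left(v,\ \frac{v}{2}-q^{e-1},\ \frac{v}{2}-q^{2e-2}-q^{e-1},\ q^{2e-2}-q^{e-1},\ 2,\ \frac{v}{2}\right).$$
   Context: A $k$-regular graph on $v$ vertices is a divisible design graph with parameters $(v,k,\lambda_1,\lambda_2,m,n)$ if its vertex set can be partitioned into $m$ classes of size $n$ such that any two distinct vertices from the same class have exactly $\lambda_1$ common neighbours and any two vertices from different classes have exactly $\lambda_2$ common neighbours. Let $\zeta$ be a symplectic polarity of $\mathrm{PG}(2e-1,q)$, i.e. a polarity with $x\in x^\zeta$ for every point $x$. The symplectic graph $Sp(2e,q)$ has the points of $\mathrm{PG}(2e-1,q)$ as vertices, two distinct points $x,y$ being adjacent iff $y\in x^\zeta$. A subspace $\pi$ is totally isotropic if $\pi\subseteq\pi^\zeta$. A symplectic spread is a set of totally isotropic subspaces of projective dimension $e-1$ partitioning the point set of $\mathrm{PG}(2e-1,q)$; it corresponds to a partition of the vertices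 of $Sp(2e,q)$ into $q^e+1$ cliques of order $(q^e-1)/(q-1)$. -}

module Defs where

open import Level using (Level; _⊔_; suc; 0ℓ)
open import Algebra.Bundles using (CommutativeRing)
open import Algebra.Apartness.Bundles using (HeytingField; HeytingCommutativeRing)
open import Data.Fin.Base using (Fin)
open import Data.Nat.Base as ℕ using (ℕ; _∸_; _^_; NonZero; >-nonZero; s≤s; z≤n)
import Data.Nat.Properties as ℕ
open import Data.Nat.Divisibility using (_∤_; _∣0)
open import Data.Nat.Primality using (Prime; prime⇒nonTrivial; prime⇒nonZero)
open import Data.Product.Base using (∃; ∃-syntax; _×_; _,_; proj₁; proj₂)
import Data.Product.Base as Product
open import Data.Sum.Base using (_⊎_; inj₁; inj₂)
open import Data.Vec.Functional using (Vector)
import Data.Vec.Functional.Relation.Binary.Equality.Setoid as VecEq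
open import Function.Base using (_∘_)
open import Function.Bundles using (Func; Inverse; _⇔_)
open import Relation.Binary.Bundles using (Setoid)
open import Relation.Binary.Core using (Rel)
open import Relation.Binary.Definitions using (Symmetric; Irreflexive; _Respects_; _Respects₂_)
import Relation.Binary.Construct.On as On
open import Relation.Binary.PropositionalEquality as ≡ using (_≡_; _≢_)
open import Relation.Nullary using (¬_)
open import Relation.Unary using (Pred; Decidable; _⊆_; _∩_)
open import Relation.Unary.Relation.Binary.Equality using (≐-setoid)

private
  variable
    a b c p r ℓ ℓ₁ ℓ₂ : Level

record OddPrimePower (q : ℕ) : Set where
  field
    base        : ℕ
    exponent    : ℕ
    base-prime  : Prime base
    exponent≥1  : 1 ℕ.≤ exponent
    isPower     : q ≡ base ^ exponent
    odd         : 2 ∤ q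

-- Needed to form quotients by q ∸ 1.
q∸1-nonZero : ∀ {q} → OddPrimePower q → NonZero (q ∸ 1)
q∸1-nonZero {ℕ.zero} opp with () ← OddPrimePower.odd opp (2 ∣0)
q∸1-nonZero {ℕ.suc (ℕ.suc q)} _ = _
q∸1-nonZero {ℕ.suc ℕ.zero} opp with OddPrimePower.exponent≥1 opp
... | s≤s {n = k} z≤n = ≡.subst (λ t → NonZero (t ∸ 1)) (≡.sym isPower)
        (>-nonZero (ℕ.m<n⇒0<n∸m 1<bᵏ⁺¹))
  where
  open OddPrimePower opp
  instance _ = prime⇒nonTrivial base-prime
  instance _ = prime⇒nonZero base-prime
  instance _ = ℕ.m^n≢0 base k
  1<bᵏ⁺¹ : 1 ℕ.< base ^ ℕ.suc k
  1<bᵏ⁺¹ = ℕ.<-≤-trans (ℕ.nonTrivial⇒n>1 base) (ℕ.m≤m*n base (base ^ k))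

-- Elements are counted up to the equality of the setoid.
HasSize : Setoid a ℓ → ℕ → Set (a ⊔ ℓ)
HasSize S n = Inverse S (≡.setoid (Fin n))

subsetoid : (S : Setoid a ℓ) → Pred (Setoid.Carrier S) p → Setoid (a ⊔ p) ℓ
subsetoid S P = On.setoid S (proj₁ {B = P})

-- An ordered partition of S into m classes, given by the class of each
-- element; this makes membership of a class decidable.
Partition : Setoid a ℓ → ℕ → Set (a ⊔ ℓ)
Partition S m = Func S (≡.setoid (Fin m))

module _ {S : Setoid a ℓ} {m : ℕ} (P : Partition S m) where

  classOf : Setoid.Carrier S → Fin m
  classOf = Func.to P

  Class : Fin m → Pred (Setoid.Carrier S) 0ℓ
  Class i x = classOf x ≡ i

record Graph a ℓ r : Set (suc (a ⊔ ℓ ⊔ r)) where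
  infix 4 _~_
  field
    vertices : Setoid a ℓ
  open Setoid vertices public using (_≈_; _≉_) renaming (Carrier to Vertex)
  field
    _~_      : Rel Vertex r
    ~-resp   : _~_ Respects₂ _≈_
    ~-sym    : Symmetric _~_
    ~-irrefl : Irreflexive _≈_ _~_

record IsDivisibleDesignGraph (G : Graph a ℓ r) (v k λ₁ λ₂ m n : ℕ) : Set (a ⊔ ℓ ⊔ r) where
  open Graph G
  field
    order          : HasSize vertices v
    regular        : ∀ x → HasSize (subsetoid vertices (x ~_)) k
    partition      : Partition vertices m
    class-size     : ∀ i → HasSize (subsetoid vertices (Class partition i)) n
    same-class     : ∀ {x y} → x ≉ y → classOf partition x ≡ classOf partition y →
                     HasSize (subsetoid vertices ((x ~_) ∩ (y ~_))) λ₁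
    distinct-class : ∀ {x y} → classOf partition x ≢ classOf partition y →
                     HasSize (subsetoid vertices ((x ~_) ∩ (y ~_))) λ₂

complementWithinClasses : (G : Graph a ℓ r) {m : ℕ} →
  Partition (Graph.vertices G) m → Graph a ℓ (ℓ ⊔ r)
complementWithinClasses {ℓ = ℓ} {r = r} G P = record
  { vertices = vertices
  ; _~_      = _~′_
  ; ~-resp   = respʳ , λ x≈y → sym′ ∘ respʳ x≈y ∘ sym′
  ; ~-sym    = sym′
  ; ~-irrefl = irrefl′
  }
  where
  open Graph G
  open Setoid vertices using (sym; trans)
  cl = classOf P

  _~′_ : Rel Vertex (ℓ ⊔ r)
  x ~′ y = (cl x ≡ cl y × x ≉ y × ¬ x ~ y) ⊎ (cl x ≢ cl y × x ~ y)

  sym′ : Symmetric _~′_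
  sym′ (inj₁ (c≡ , x≉y , x≁y)) = inj₁ (≡.sym c≡ , x≉y ∘ sym , x≁y ∘ ~-sym)
  sym′ (inj₂ (c≢ , x~y))       = inj₂ (c≢ ∘ ≡.sym , ~-sym x~y)

  respʳ : ∀ {x y z} → y ≈ z → x ~′ y → x ~′ z
  respʳ y≈z (inj₁ (c≡ , x≉y , x≁y)) = inj₁
    ( ≡.trans c≡ (Func.cong P y≈z)
    , (λ x≈z → x≉y (trans x≈z (sym y≈z)))
    , x≁y ∘ proj₁ ~-resp (sym y≈z) )
  respʳ y≈z (inj₂ (c≢ , x~y)) = inj₂
    ( (λ c≡ → c≢ (≡.trans c≡ (≡.sym (Func.cong P y≈z))))
    , proj₁ ~-resp y≈z x~y )

  irrefl′ : Irreflexive _≈_ _~′_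
  irrefl′ x≈y (inj₁ (_ , x≉y , _)) = x≉y x≈y
  irrefl′ x≈y (inj₂ (_ , x~y))     = ~-irrefl x≈y x~y

-- In a Heyting field an element is apart from 0# exactly when it is
-- invertible; over a finite carrier these are the elements other than 0#.
HeytingField-setoid : HeytingField c ℓ₁ ℓ₂ → Setoid c ℓ₁
HeytingField-setoid F = CommutativeRing.setoid
  (HeytingCommutativeRing.commutativeRing (HeytingField.heytingCommutativeRing F))

-- The projective geometry PG(N-1, F): the subspaces of the vector space Fᴺ.
module PG (F : HeytingField c ℓ₁ ℓ₂) (N : ℕ) where

  open CommutativeRing
    (HeytingCommutativeRing.commutativeRing (HeytingField.heytingCommutativeRing F))
  open import Algebra.Definitions.RawMonoid +-rawMonoid using (sum)
  open VecEq setoid using (_≋_)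

  𝕍 : Set c
  𝕍 = Vector Carrier N

  0ᵛ : 𝕍
  0ᵛ _ = 0#

  infixl 6 _+ᵛ_
  _+ᵛ_ : 𝕍 → 𝕍 → 𝕍
  (x +ᵛ y) i = x i + y i

  infixl 7 _·ᵛ_
  _·ᵛ_ : Carrier → 𝕍 → 𝕍
  (s ·ᵛ x) i = s * x i

  lincomb : ∀ {d} → Vector Carrier d → Vector 𝕍 d → 𝕍
  lincomb s u i = sum (λ j → s j * u j i)

  -- Membership is required to be decidable, as it is, classically, for
  -- every subspace.
  record Subspace : Set (suc (c ⊔ ℓ₁)) where
    field
      Member   : Pred 𝕍 (c ⊔ ℓ₁)
      resp     : Member Respects _≋_
      0-closed : Member 0ᵛ
      +-closed : ∀ {x y} → Member x → Member y → Member (x +ᵛ y)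
      ·-closed : ∀ s {x} → Member x → Member (s ·ᵛ x)
      member?  : Decidable Member

  open Subspace public using (Member)

  subspaces : Setoid (suc (c ⊔ ℓ₁)) (c ⊔ ℓ₁)
  subspaces = On.setoid (≐-setoid 𝕍 (c ⊔ ℓ₁)) Member

  open Setoid subspaces public using () renaming (_≈_ to _≐ˢ_)

  infix 4 _⊆ˢ_
  _⊆ˢ_ : Rel Subspace (c ⊔ ℓ₁)
  U ⊆ˢ W = Member U ⊆ Member W

  -- Vector space dimension d, that is, projective dimension d - 1.
  record HasDim (U : Subspace) (d : ℕ) : Set (c ⊔ ℓ₁) where
    field
      basis       : Vector 𝕍 d
      members     : ∀ j → Member U (basis j)
      independent : ∀ s → lincomb s basis ≋ 0ᵛ → ∀ j → s j ≈ 0#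
      spanning    : ∀ {x} → Member U x → ∃[ s ] lincomb s basis ≋ x

  record Point : Set (suc (c ⊔ ℓ₁)) where
    field
      subspace : Subspace
      dim≡1    : HasDim subspace 1

  open Point public using (subspace)

  points : Setoid (suc (c ⊔ ℓ₁)) (c ⊔ ℓ₁)
  points = On.setoid subspaces subspace

  infix 4 _∈ˢ_
  _∈ˢ_ : Point → Subspace → Set (c ⊔ ℓ₁)
  x ∈ˢ U = subspace x ⊆ˢ U

  record Polarity : Set (suc (c ⊔ ℓ₁)) where
    field
      ζ          : Subspace → Subspace
      antitone   : ∀ U W → U ⊆ˢ W → ζ W ⊆ˢ ζ U
      involutive : ∀ U → ζ (ζ U) ≐ˢ U

    _^ζ : Point → Subspace
    x ^ζ = ζ (subspace x)

  record SymplecticPolarity : Set (suc (c ⊔ ℓ₁)) where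
    field
      polarity : Polarity
    open Polarity polarity public
    field
      symplectic : ∀ x → x ∈ˢ x ^ζ

  module _ (Z : SymplecticPolarity) where

    open SymplecticPolarity Z

    symplecticGraph : Graph (suc (c ⊔ ℓ₁)) (c ⊔ ℓ₁) (c ⊔ ℓ₁)
    symplecticGraph = record
      { vertices = points
      ; _~_      = _~_
      ; ~-resp   = (λ {x} {y} {z} → respʳ {x} {y} {z}) ,
                   (λ {x} {y} {z} y≈z y~x →
                     sym′ {x} {z} (respʳ {x} {y} {z} y≈z (sym′ {y} {x} y~x)))
      ; ~-sym    = λ {x} {y} → sym′ {x} {y}
      ; ~-irrefl = λ x≈y x~y → proj₁ x~y x≈y
      }
      where
      module P = Setoid points

      _~_ : Rel Point (c ⊔ ℓ₁)
      x ~ y = ¬ (x P.≈ y) × y ∈ˢ x ^ζ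

      sym′ : Symmetric _~_
      sym′ {x} {y} (x≉y , y∈xζ) =
        (λ y≈x → x≉y (Product.swap y≈x)) ,
        (λ x∋u → antitone (subspace y) (x ^ζ) y∈xζ (proj₂ (involutive (subspace x)) x∋u))

      respʳ : ∀ {x y z} → y P.≈ z → x ~ y → x ~ z
      respʳ {x} {y} {z} y≈z (x≉y , y∈xζ) =
        (λ x≈z → x≉y (P.trans {x} {z} {y} x≈z (Product.swap y≈z))) ,
        (λ z∋u → y∈xζ (proj₂ y≈z z∋u))

    TotallyIsotropic : Subspace → Set (c ⊔ ℓ₁)
    TotallyIsotropic U = U ⊆ˢ ζ U

    -- Here e is the vector space dimension of the members.
    record IsSymplecticSpread (e : ℕ) (R : Pred Subspace r) : Set (suc (c ⊔ ℓ₁) ⊔ r) where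
      field
        resp      : R Respects _≐ˢ_
        isotropic : ∀ {U} → R U → TotallyIsotropic U
        dim       : ∀ {U} → R U → HasDim U e
        cover     : ∀ x → ∃[ U ] R U × x ∈ˢ U
        disjoint  : ∀ {U W} x → R U → R W → x ∈ˢ U → x ∈ˢ W → U ≐ˢ W

  -- V is the union of (the point sets of) k distinct members of R.
  record IsUnionOf (k : ℕ) (R : Pred Subspace r) (V : Pred Point p)
         : Set (suc (c ⊔ ℓ₁) ⊔ r ⊔ p) where
    field
      part     : Fin k → Subspace
      part∈R   : ∀ j → R (part j)
      distinct : ∀ {i j} → part i ≐ˢ part j → i ≡ j
      union    : ∀ x → V x ⇔ (∃[ j ] x ∈ˢ part j)

{-# OPTIONS --safe #-}
-- A vertex z is adjacent to x in the new graph iff exactly one of "z lies in the class of x"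
-- and "z ∈ x^ζ" holds, so degrees and numbers of common neighbours follow, by identities
-- between indicator functions, from the sizes of the sets x^ζ, x^ζ ∩ y^ζ, V_i and V_i ∩ x^ζ.
-- As ζ is an antitone involution, x^ζ is a maximal proper subspace H, and a subspace W not
-- inside H satisfies |W| = q |W ∩ H|.  A spread member lies in x^ζ if it contains x, and
-- otherwise meets x^ζ in a hyperplane of itself.

module Submission where

open import Defs
open import Level using (Level; _⊔_; Lift; lift)
open import Algebra.Apartness.Bundles using (HeytingField; HeytingCommutativeRing)
import Algebra.Apartness.Properties.HeytingCommutativeRing as HCRProperties
open import Algebra.Bundles using (CommutativeRing)
import Algebra.Properties.CommutativeMonoid.Sum as MonoidSum
import Algebra.Properties.CommutativeSemigroup as CommutativeSemigroupProperties
import Algebra.Properties.Ring as RingProperties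
import Algebra.Properties.Semiring.Sum as SemiringSum
open import Data.Bool.Base using (Bool; true; false; not; _∧_; _∨_; if_then_else_)
open import Data.Fin.Base using (Fin; zero; suc; combine; finToFun; funToFin; opposite)
import Data.Fin.Properties as Fin
open import Data.Fin.Permutation using (↔⇒≡)
open import Data.Nat.Base as ℕ using (ℕ; zero; suc; s≤s; _^_)
import Data.Nat.Properties as ℕ
open import Data.Nat.Divisibility using (_∣0)
open import Data.Nat.DivMod using (m*n/n≡m)
import Data.Product.Base as Product
open import Data.Product.Base using (∃; ∃-syntax; _×_; _,_; proj₁; proj₂)
open import Data.Product.Function.NonDependent.Propositional using (_×-⇔_)
open import Data.Product.Function.NonDependent.Setoid using (_×-inverse_)
open import Data.Product.Relation.Binary.Pointwise.NonDependent using (_×ₛ_; Pointwise-≡↔≡)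
open import Data.Sum.Base using (_⊎_; inj₁; inj₂)
open import Data.Unit.Base using (⊤; tt)
open import Data.Vec.Functional using (Vector)
import Data.Vec.Functional.Relation.Binary.Equality.Setoid as VecEq
open import Function.Base using (_∘_)
open import Function.Bundles using (Func; Inverse; _⇔_; mk⇔; Equivalence)
import Function.Construct.Composition as Compose
import Function.Construct.Symmetry as Symmetry
open import Relation.Binary.Bundles using (Setoid)
open import Relation.Binary.Definitions as Binary using (_Respects_)
open import Relation.Binary.PropositionalEquality as ≡ using (_≡_; _≢_; _≗_; cong; cong₂)
import Relation.Binary.Reasoning.Setoid as SetoidReasoning
open import Relation.Nullary using (¬_; Dec; yes; no; does; contradiction)
open import Relation.Nullary.Decidable
  using (map′; _×-dec_; _⊎-dec_; ¬?; dec-true; dec-false; decidable-stable)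
open import Relation.Unary using (Pred; Decidable; _∩_)

-- The polarity is given only as an antitone involution of the subspace lattice. No bilinear form is
-- at hand, so orthogonality cannot be computed in coordinates. Counting replaces linear algebra: a
-- subspace is treated as d-dimensional when its vector set has q^d elements, and such sizes pass to
-- hyperplane sections although these come without a basis. Write G(d) = 1 + q + ... + q^(d-1) and M
-- for the number of spread members in each class. A class has M G(e) points. A polar x^ζ has M
-- G(e-1) points in the class that misses x, and q^(e-1) = G(e) - G(e-1) more in the class of x,
-- because of the one member through x. This surplus is the origin of the term q^(e-1) in k, λ₁ and
-- λ₂. The number M is eliminated by adding up the two classes, once in the whole space and once
-- inside x^ζ. Since subtraction of naturals truncates, all identities are kept additive until the
-- parameters are read off.

private
  variable
    a b c p r ℓ ℓ₁ ℓ₂ : Level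

open MonoidSum ℕ.+-0-commutativeMonoid using (sum)

-- Counting in finite setoids

module _ where
  open import Data.Nat.Base using (_+_; _*_; _≤_)
  open MonoidSum ℕ.+-0-commutativeMonoid using (sum-cong-≗; ∑-distrib-+; ∑-comm)

  module _ (S : Setoid a ℓ₁) (T : Setoid b ℓ₂) where
    private
      module S = Setoid S
      module T = Setoid T

    mkInverse : (to : S.Carrier → T.Carrier) (from : T.Carrier → S.Carrier) →
      (∀ x y → x S.≈ y → to x T.≈ to y) →
      (∀ x y → x T.≈ y → from x S.≈ from y) →
      (∀ y → to (from y) T.≈ y) → (∀ x → from (to x) S.≈ x) →
      Inverse S T
    mkInverse to from to-cong from-cong to∘from from∘to = record
      { to        = to
      ; from      = from
      ; to-cong   = λ {x} {y} → to-cong x y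
      ; from-cong = λ {x} {y} → from-cong x y
      ; inverse   = (λ {x} {y} y≈ → T.trans (to-cong y (from x) y≈) (to∘from x))
                  , (λ {x} {y} y≈ → S.trans (from-cong y (to x) y≈) (from∘to x))
      }

  module _ {S : Setoid a ℓ₁} {T : Setoid b ℓ₂} where

    hasSize-via : ∀ {n} → Inverse S T → HasSize T n → HasSize S n
    hasSize-via = Compose.inverse

    ×-hasSize : ∀ {m n} → HasSize S m → HasSize T n → HasSize (S ×ₛ T) (m * n)
    ×-hasSize hS hT = Compose.inverse (hS ×-inverse hT)
      (Compose.inverse Pointwise-≡↔≡ (Symmetry.inverse Fin.*↔×))

  hasSize-unique : {S : Setoid a ℓ} {m n : ℕ} → HasSize S m → HasSize S n → m ≡ n
  hasSize-unique hm hn = ↔⇒≡ (Compose.inverse (Symmetry.inverse hm) hn)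

  hasSize-≤ : {S : Setoid a ℓ₁} {T : Setoid b ℓ₂} {m n : ℕ} → HasSize S m → HasSize T n →
    (f : Func S T) → (∀ x y → Setoid._≈_ T (Func.to f x) (Func.to f y) → Setoid._≈_ S x y) →
    m ≤ n
  hasSize-≤ hS hT f f-inj = Fin.injective⇒≤ {f = hT.to ∘ Func.to f ∘ hS.from} λ {i} {j} eq →
    ≡.trans (≡.sym (hS.strictlyInverseˡ i))
      (≡.trans (hS.to-cong (f-inj _ _ (T.trans (T.sym (hT.strictlyInverseʳ _))
                                      (T.trans (hT.from-cong eq) (hT.strictlyInverseʳ _)))))
               (hS.strictlyInverseˡ j))
    where
    module hS = Inverse hS
    module hT = Inverse hT
    module T = Setoid hT.Eq₁.setoid

  Vector-hasSize : {S : Setoid a ℓ} {n : ℕ} → HasSize S n → ∀ d →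
    HasSize (VecEq.≋-setoid S d) (n ^ d)
  Vector-hasSize {S = S} {n} h d = mkInverse (VecEq.≋-setoid S d) (≡.setoid (Fin (n ^ d)))
    (λ u → funToFin (h.to ∘ u))
    (λ i → h.from ∘ finToFun i)
    (λ u w u≋w → funToFin-cong {d} (λ j → h.to-cong (u≋w j)))
    (λ { i .i ≡.refl j → S.refl })
    (λ i → ≡.trans (funToFin-cong {d} (λ j → h.strictlyInverseˡ (finToFun i j)))
                   (Fin.funToFin-finToFin {m = d} i))
    (λ u j → S.trans (h.from-cong (Fin.finToFun-funToFin (h.to ∘ u) j)) (h.strictlyInverseʳ (u j)))
    where
    module h = Inverse h
    module S = Setoid S
    funToFin-cong : ∀ {m} {f g : Fin m → Fin n} → f ≗ g → funToFin f ≡ funToFin g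
    funToFin-cong {zero}  f≗g = ≡.refl
    funToFin-cong {suc m} f≗g =
      cong₂ combine (f≗g zero) (funToFin-cong (f≗g ∘ suc))

  -- Exclusive or and indicator functions

  infix 4 _⊻_ _⊻-dec_
  infixr 5 _xor′_

  _⊻_ : Set a → Set b → Set (a ⊔ b)
  A ⊻ B = (A × ¬ B) ⊎ (¬ A × B)

  _⊻-dec_ : {A : Set a} {B : Set b} → Dec A → Dec B → Dec (A ⊻ B)
  A? ⊻-dec B? = (A? ×-dec ¬? B?) ⊎-dec (¬? A? ×-dec B?)

  -- Built in the same shape as `_⊻-dec_`, so that `does (A? ⊻-dec B?)` computes to
  -- `does A? xor′ does B?` and the set identities below become Boolean truth tables.
  _xor′_ : Bool → Bool → Bool
  x xor′ y = (x ∧ not y) ∨ (not x ∧ y)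

  ⟦_⟧ : Bool → ℕ
  ⟦ b ⟧ = if b then 1 else 0

  𝟙 : {A : Set a} → Dec A → ℕ
  𝟙 A? = ⟦ does A? ⟧

  𝟙-true : {A : Set a} (A? : Dec A) → A → 𝟙 A? ≡ 1
  𝟙-true A? x = cong ⟦_⟧ (dec-true A? x)

  𝟙-false : {A : Set a} (A? : Dec A) → ¬ A → 𝟙 A? ≡ 0
  𝟙-false A? ¬x = cong ⟦_⟧ (dec-false A? ¬x)

  𝟙-cong : {A : Set a} {B : Set b} (A? : Dec A) (B? : Dec B) → A ⇔ B → 𝟙 A? ≡ 𝟙 B?
  𝟙-cong A? (yes y) A⇔B = 𝟙-true A? (Equivalence.from A⇔B y)
  𝟙-cong A? (no ¬y) A⇔B = 𝟙-false A? (¬y ∘ Equivalence.to A⇔B)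

  sum-zero : ∀ {n} (f : Fin n → ℕ) → (∀ j → f j ≡ 0) → sum f ≡ 0
  sum-zero {zero}  f f≡0 = ≡.refl
  sum-zero {suc n} f f≡0 = cong₂ _+_ (f≡0 zero) (sum-zero (f ∘ suc) (f≡0 ∘ suc))

  sum-const : ∀ {n} c (f : Fin n → ℕ) → (∀ j → f j ≡ c) → sum f ≡ n * c
  sum-const {zero}  c f f≡c = ≡.refl
  sum-const {suc n} c f f≡c = cong₂ _+_ (f≡c zero) (sum-const c (f ∘ suc) (f≡c ∘ suc))

  -- Intended for the sections of x^ζ by the spread members of the class of x, where the member
  -- through x is the exception.
  sum-const-but-one : ∀ {n} c d (f : Fin n → ℕ) i → f i ≡ c + d →
    (∀ j → j ≢ i → f j ≡ c) → sum f ≡ n * c + d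
  sum-const-but-one {suc n} c d f zero fi f≡c = begin
    f zero + sum (f ∘ suc)  ≡⟨ cong₂ _+_ fi (sum-const c (f ∘ suc) (λ j → f≡c (suc j) λ ())) ⟩
    c + d + n * c           ≡⟨ ℕ.+-assoc c d (n * c) ⟩
    c + (d + n * c)         ≡⟨ cong (c +_) (ℕ.+-comm d (n * c)) ⟩
    c + (n * c + d)         ≡⟨ ℕ.+-assoc c (n * c) d ⟨
    c + n * c + d           ∎
    where open ≡.≡-Reasoning
  sum-const-but-one {suc n} c d f (suc i) fi f≡c = begin
    f zero + sum (f ∘ suc)  ≡⟨ cong₂ _+_ (f≡c zero λ ())
                                 (sum-const-but-one c d (f ∘ suc) i fi
                                   (λ j j≢i → f≡c (suc j) (j≢i ∘ Fin.suc-injective))) ⟩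
    c + (n * c + d)         ≡⟨ ℕ.+-assoc c (n * c) d ⟨
    c + n * c + d           ∎
    where open ≡.≡-Reasoning

  𝟙-disjoint-∃ : ∀ {n} {A : Set a} (A? : Dec A) {Q : Fin n → Set b} (Q? : ∀ j → Dec (Q j)) →
    A ⇔ ∃ Q → (∀ i j → Q i → Q j → i ≡ j) → 𝟙 A? ≡ sum (λ j → 𝟙 (Q? j))
  𝟙-disjoint-∃ (no ¬x) Q? A⇔∃Q unique =
    ≡.sym (sum-zero _ λ j → 𝟙-false (Q? j) λ y → ¬x (Equivalence.from A⇔∃Q (j , y)))
  𝟙-disjoint-∃ {n = n} (yes x) Q? A⇔∃Q unique with i , y ← Equivalence.to A⇔∃Q x = ≡.sym (begin
    sum (λ j → 𝟙 (Q? j))  ≡⟨ sum-const-but-one 0 1 _ i (𝟙-true (Q? i) y)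
                               (λ j j≢i → 𝟙-false (Q? j) λ z → j≢i (unique j i z y)) ⟩
    n * 0 + 1             ≡⟨ cong (_+ 1) (ℕ.*-zeroʳ n) ⟩
    1                     ∎)
    where open ≡.≡-Reasoning

  Fin-subset-hasSize : ∀ {n} {P : Pred (Fin n) p} (P? : Decidable P) →
    HasSize (subsetoid (≡.setoid (Fin n)) P) (sum (λ i → 𝟙 (P? i)))
  Fin-subset-hasSize {n = zero} P? = mkInverse (subsetoid _ _) (≡.setoid _)
    (λ ()) (λ ()) (λ ()) (λ ()) (λ ()) (λ ())
  Fin-subset-hasSize {n = suc n} {P} P? with P? zero
  ... | yes p₀ = mkInverse (subsetoid _ P) (≡.setoid _) to from to-cong
          (λ { x .x ≡.refl → ≡.refl }) to∘from from∘to
    where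
    module h = Inverse (Fin-subset-hasSize (P? ∘ suc))
    to : ∃ P → Fin _
    to (zero  , _) = zero
    to (suc i , q) = suc (h.to (i , q))
    from : Fin _ → ∃ P
    from zero    = zero , p₀
    from (suc k) = suc (proj₁ (h.from k)) , proj₂ (h.from k)
    to-cong : ∀ x y → proj₁ x ≡ proj₁ y → to x ≡ to y
    to-cong (zero  , _) (.zero    , _) ≡.refl = ≡.refl
    to-cong (suc i , _) (.(suc i) , _) ≡.refl = cong suc (h.to-cong ≡.refl)
    to∘from : ∀ k → to (from k) ≡ k
    to∘from zero    = ≡.refl
    to∘from (suc k) = cong suc (h.strictlyInverseˡ k)
    from∘to : ∀ x → proj₁ (from (to x)) ≡ proj₁ x
    from∘to (zero  , _) = ≡.refl
    from∘to (suc i , q) = cong suc (h.strictlyInverseʳ (i , q))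
  ... | no ¬p₀ = mkInverse (subsetoid _ P) (≡.setoid _) to from to-cong
          (λ { x .x ≡.refl → ≡.refl }) h.strictlyInverseˡ from∘to
    where
    module h = Inverse (Fin-subset-hasSize (P? ∘ suc))
    to : ∃ P → Fin _
    to (zero  , q) = contradiction q ¬p₀
    to (suc i , q) = h.to (i , q)
    from : Fin _ → ∃ P
    from k = suc (proj₁ (h.from k)) , proj₂ (h.from k)
    to-cong : ∀ x y → proj₁ x ≡ proj₁ y → to x ≡ to y
    to-cong (zero  , q) _ _ = contradiction q ¬p₀
    to-cong (suc i , _) (.(suc i) , _) ≡.refl = h.to-cong ≡.refl
    from∘to : ∀ x → proj₁ (from (to x)) ≡ proj₁ x
    from∘to (zero  , q) = contradiction q ¬p₀
    from∘to (suc i , q) = cong suc (h.strictlyInverseʳ (i , q))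

  -- Cardinalities of decidable subsets of a finite setoid

  module Counting {S : Setoid a ℓ} {n : ℕ} (h : HasSize S n) where
    open Setoid S using (Carrier; _≈_; refl; sym; trans)
    private module h = Inverse h

    opaque
      -- The predicate is tested only on the representatives `h.from i`, so identities between
      -- counts can be proved termwise. Respect for the setoid equality enters when a count is
      -- turned into a `HasSize`.
      # : {P : Pred Carrier p} → Decidable P → ℕ
      # P? = sum (λ i → 𝟙 (P? (h.from i)))

      #-hasSize : {P : Pred Carrier p} → P Respects _≈_ → (P? : Decidable P) →
        HasSize (subsetoid S P) (# P?)
      #-hasSize {P = P} resp P? = hasSize-via
        (mkInverse (subsetoid S P) (subsetoid (≡.setoid (Fin n)) (P ∘ h.from))
          (λ (x , px) → h.to x , resp (sym (h.strictlyInverseʳ x)) px)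
          (λ (i , q) → h.from i , q)
          (λ _ _ → h.to-cong)
          (λ { _ _ ≡.refl → refl })
          (λ (i , _) → h.strictlyInverseˡ i)
          (λ (x , _) → h.strictlyInverseʳ x))
        (Fin-subset-hasSize (P? ∘ h.from))

      #-hasSize-⇔ : {P : Pred Carrier p} {Q : Pred Carrier r} → P Respects _≈_ →
        (Q? : Decidable Q) → (∀ x → P x ⇔ Q x) → HasSize (subsetoid S P) (# Q?)
      #-hasSize-⇔ {P = P} resp Q? P⇔Q = #-hasSize {P = P} resp (λ x →
        map′ (Equivalence.from (P⇔Q x)) (Equivalence.to (P⇔Q x)) (Q? x))

      #-cong : {P : Pred Carrier p} {Q : Pred Carrier r} (P? : Decidable P) (Q? : Decidable Q) →
        (∀ x → P x ⇔ Q x) → # P? ≡ # Q?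
      #-cong P? Q? P⇔Q = sum-cong-≗ {n} λ i → 𝟙-cong (P? _) (Q? _) (P⇔Q _)

      #-∃ : ∀ {m} {P : Pred Carrier p} (P? : Decidable P)
        {Q : Fin m → Pred Carrier r} (Q? : ∀ j → Decidable (Q j)) →
        (∀ x → P x ⇔ (∃[ j ] Q j x)) → (∀ x i j → Q i x → Q j x → i ≡ j) →
        # P? ≡ sum (λ j → # (Q? j))
      #-∃ P? Q? P⇔∃Q unique = ≡.trans
        (sum-cong-≗ {n} λ i → 𝟙-disjoint-∃ (P? _) (λ j → Q? j _) (P⇔∃Q _) (unique _))
        (∑-comm λ i j → 𝟙 (Q? j (h.from i)))

      all-# : {P : Pred Carrier p} (P? : Decidable P) → (∀ x → P x) → # P? ≡ n
      all-# P? all = ≡.trans (sum-const {n} 1 _ λ i → 𝟙-true (P? _) (all _)) (ℕ.*-identityʳ n)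

      #-singleton : {P : Pred Carrier p} (P? : Decidable P) {x : Carrier} →
        (∀ y → P y ⇔ y ≈ x) → # P? ≡ 1
      #-singleton {P = P} P? {x} P⇔≈x = hasSize-unique (#-hasSize resp P?)
        (mkInverse (subsetoid S P) (≡.setoid (Fin 1)) (λ _ → zero)
          (λ _ → x , Equivalence.from (P⇔≈x x) refl)
          (λ _ _ _ → ≡.refl) (λ _ _ _ → refl) (λ { zero → ≡.refl })
          (λ (y , py) → sym (Equivalence.to (P⇔≈x y) py)))
        where
        resp : P Respects _≈_
        resp {y} {z} y≈z py = Equivalence.from (P⇔≈x z)
          (trans (sym y≈z) (Equivalence.to (P⇔≈x y) py))

      #-complement : {P : Pred Carrier p} (P? : Decidable P) → # P? + # (λ x → ¬? (P? x)) ≡ n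
      #-complement P? = ≡.trans (≡.sym (∑-distrib-+ {n} _ _)) (≡.trans
        (sum-const {n} 1 _ λ i → pointwise (does (P? (h.from i)))) (ℕ.*-identityʳ n))
        where
        pointwise : ∀ c → ⟦ c ⟧ + ⟦ not c ⟧ ≡ 1
        pointwise true  = ≡.refl
        pointwise false = ≡.refl

      -- Finiteness takes the place of excluded middle: this supplies inverses, decidable membership
      -- in spans, and vectors outside a subspace.
      search : {P : Pred Carrier p} → P Respects _≈_ → Decidable P → Dec (∃ P)
      search resp P? = map′ (λ (i , q) → h.from i , q)
        (λ (x , px) → h.to x , resp (sym (h.strictlyInverseʳ x)) px)
        (Fin.any? (P? ∘ h.from))

      infix 4 _≈?_
      _≈?_ : Binary.Decidable _≈_
      x ≈? y = map′ (λ eq → trans (sym (h.strictlyInverseʳ x))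
                             (trans (h.from-cong eq) (h.strictlyInverseʳ y)))
                    h.to-cong (h.to x Fin.≟ h.to y)

      #-split : {C : Pred Carrier b} {X : Pred Carrier p} (C? : Decidable C) (X? : Decidable X) →
        # (λ z → C? z ×-dec X? z) + # (λ z → ¬? (C? z) ×-dec X? z) ≡ # X?
      #-split C? X? = ≡.trans (≡.sym (∑-distrib-+ {n} _ _))
        (sum-cong-≗ {n} λ i → pointwise (does (C? (h.from i))) (does (X? (h.from i))))
        where
        pointwise : ∀ c x → ⟦ c ∧ x ⟧ + ⟦ not c ∧ x ⟧ ≡ ⟦ x ⟧
        pointwise true  true  = ≡.refl
        pointwise true  false = ≡.refl
        pointwise false x     = ≡.refl

      #-⊻ : {C : Pred Carrier b} {X : Pred Carrier p} (C? : Decidable C) (X? : Decidable X) →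
        # (λ z → C? z ⊻-dec X? z) + # (λ z → C? z ×-dec X? z)
          ≡ # C? + # (λ z → ¬? (C? z) ×-dec X? z)
      #-⊻ C? X? = ≡.trans (≡.sym (∑-distrib-+ {n} _ _)) (≡.trans
        (sum-cong-≗ {n} λ i → pointwise (does (C? (h.from i))) (does (X? (h.from i))))
        (∑-distrib-+ {n} _ _))
        where
        pointwise : ∀ c x → ⟦ c xor′ x ⟧ + ⟦ c ∧ x ⟧ ≡ ⟦ c ⟧ + ⟦ not c ∧ x ⟧
        pointwise true  true  = ≡.refl
        pointwise true  false = ≡.refl
        pointwise false x     = ℕ.+-identityʳ ⟦ x ⟧

      -- On C the two exclusive ors have indicators 1 - x and 1 - y, and (1 - x)(1 - y) + x + y = 1
      -- + xy. Off C both sides are xy. With C the common class of two vertices and X, Y their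
      -- polars, this counts common neighbours.
      #-⊻-⊻ : {C : Pred Carrier b} {X : Pred Carrier p} {Y : Pred Carrier r}
        (C? : Decidable C) (X? : Decidable X) (Y? : Decidable Y) →
        # (λ z → (C? z ⊻-dec X? z) ×-dec (C? z ⊻-dec Y? z))
                + (# (λ z → C? z ×-dec X? z) + # (λ z → C? z ×-dec Y? z))
            ≡ # C? + # (λ z → X? z ×-dec Y? z)
      #-⊻-⊻ C? X? Y? = ≡.trans (cong (# (λ z → (C? z ⊻-dec X? z) ×-dec (C? z ⊻-dec Y? z)) +_)
          (≡.sym (∑-distrib-+ {n} _ _)))
        (≡.trans (≡.sym (∑-distrib-+ {n} _ _)) (≡.trans
          (sum-cong-≗ {n} λ i → pointwise (does (C? (h.from i))) (does (X? (h.from i)))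
            (does (Y? (h.from i))))
          (∑-distrib-+ {n} _ _)))
        where
        pointwise : ∀ c x y →
          ⟦ (c xor′ x) ∧ (c xor′ y) ⟧ + (⟦ c ∧ x ⟧ + ⟦ c ∧ y ⟧) ≡ ⟦ c ⟧ + ⟦ x ∧ y ⟧
        pointwise true  true  true  = ≡.refl
        pointwise true  true  false = ≡.refl
        pointwise true  false true  = ≡.refl
        pointwise true  false false = ≡.refl
        pointwise false true  true  = ≡.refl
        pointwise false true  false = ≡.refl
        pointwise false false y     = ≡.refl

      -- The variant for vertices in different classes, where the class of the second is the
      -- complement of C. On C it reads (1 - x)y + xy = y, off C it reads x(1 - y) + xy = x.
      #-⊻-⊻¬ : {C : Pred Carrier b} {X : Pred Carrier p} {Y : Pred Carrier r}
        (C? : Decidable C) (X? : Decidable X) (Y? : Decidable Y) →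
        # (λ z → (C? z ⊻-dec X? z) ×-dec (¬? (C? z) ⊻-dec Y? z))
                 + # (λ z → X? z ×-dec Y? z)
             ≡ # (λ z → C? z ×-dec Y? z) + # (λ z → ¬? (C? z) ×-dec X? z)
      #-⊻-⊻¬ C? X? Y? = ≡.trans (≡.sym (∑-distrib-+ {n} _ _)) (≡.trans
        (sum-cong-≗ {n} λ i → pointwise (does (C? (h.from i))) (does (X? (h.from i)))
          (does (Y? (h.from i))))
        (∑-distrib-+ {n} _ _))
        where
        pointwise : ∀ c x y →
          ⟦ (c xor′ x) ∧ (not c xor′ y) ⟧ + ⟦ x ∧ y ⟧ ≡ ⟦ c ∧ y ⟧ + ⟦ not c ∧ x ⟧
        pointwise true  true  true  = ≡.refl
        pointwise true  true  false = ≡.refl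
        pointwise true  false true  = ≡.refl
        pointwise true  false false = ≡.refl
        pointwise false true  true  = ≡.refl
        pointwise false true  false = ≡.refl
        pointwise false false y     = ≡.refl

  -- With `t` = q - 1 this is (q^d - 1)/(q - 1), the number of points of a projective space of
  -- vector space dimension `d`. Taking q - 1 as the argument avoids subtraction, and the recursion
  -- makes the surplus q^d between consecutive dimensions definitional.
  geometricSum : ℕ → ℕ → ℕ
  geometricSum t zero    = 0
  geometricSum t (suc d) = geometricSum t d + suc t ^ d

  geometricSum-closed : ∀ t d → geometricSum t d * t + 1 ≡ suc t ^ d
  geometricSum-closed t zero    = ≡.refl
  geometricSum-closed t (suc d) = begin
    (g + x) * t + 1      ≡⟨ cong (_+ 1) (ℕ.*-distribʳ-+ t g x) ⟩
    g * t + x * t + 1    ≡⟨ ℕ.+-assoc (g * t) (x * t) 1 ⟩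
    g * t + (x * t + 1)  ≡⟨ cong (g * t +_) (ℕ.+-comm (x * t) 1) ⟩
    g * t + (1 + x * t)  ≡⟨ ℕ.+-assoc (g * t) 1 (x * t) ⟨
    g * t + 1 + x * t    ≡⟨ cong₂ _+_ (geometricSum-closed t d) (ℕ.*-comm x t) ⟩
    x + t * x            ∎
    where
    open ≡.≡-Reasoning
    g = geometricSum t d
    x = suc t ^ d

-- Linear algebra and projective geometry over a finite field

module FiniteField (F : HeytingField c ℓ₁ ℓ₂) {t : ℕ} .{{_ : ℕ.NonZero t}}
  (hF : HasSize (HeytingField-setoid F) (suc t)) where

  open HeytingField F using (_#_; tight; #-irrefl; #⇒invertible; heytingCommutativeRing)
  open HCRProperties heytingCommutativeRing using (1#0; x-0≈x)
  open CommutativeRing (HeytingCommutativeRing.commutativeRing heytingCommutativeRing)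
    hiding (zero)
  open VecEq setoid using (_≋_; ≋-setoid; ≋-sym; ≋-trans)
  open SetoidReasoning setoid
  private module K = Counting hF
  open K using (_≈?_)

  1≉0 : ¬ 1# ≈ 0#
  1≉0 1≈0 = #-irrefl 1≈0 1#0

  -- The field axioms invert only elements apart from 0, which is stronger than being unequal to 0.
  -- If the exhaustive search finds no inverse, then x is not apart from 0, and tightness makes it
  -- equal to 0.
  invert : ∀ x → ¬ x ≈ 0# → ∃[ y ] y * x ≈ 1#
  invert x x≉0 with K.search {P = λ y → y * x ≈ 1#} (λ y≈z → trans (*-congʳ (sym y≈z)))
                      (λ y → y * x ≈? 1#)
  ... | yes inverse = inverse
  ... | no ¬inverse = contradiction (proj₁ (tight x 0#) ¬x#0) x≉0
    where
    ¬x#0 : ¬ x # 0#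
    ¬x#0 x#0 with y , yx≈1 , _ ← #⇒invertible x#0 =
      ¬inverse (y , trans (*-congˡ (sym (x-0≈x x))) yx≈1)

  *-cancelʳ-nonZero : ∀ {x} → ¬ x ≈ 0# → ∀ {y z} → y * x ≈ z * x → y ≈ z
  *-cancelʳ-nonZero {x} x≉0 {y} {z} yx≈zx = trans (sym (undo y)) (trans (*-congʳ yx≈zx) (undo z))
    where
    x⁻¹ = proj₁ (invert x x≉0)
    undo : ∀ w → w * x * x⁻¹ ≈ w
    undo w = begin
      w * x * x⁻¹    ≈⟨ *-assoc w x x⁻¹ ⟩
      w * (x * x⁻¹)  ≈⟨ *-congˡ (*-comm x x⁻¹) ⟩
      w * (x⁻¹ * x)  ≈⟨ *-congˡ (proj₂ (invert x x≉0)) ⟩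
      w * 1#         ≈⟨ *-identityʳ w ⟩
      w              ∎

  *≈0⇒≈0 : ∀ {x y} → ¬ x ≈ 0# → y * x ≈ 0# → y ≈ 0#
  *≈0⇒≈0 x≉0 yx≈0 = *-cancelʳ-nonZero x≉0 (trans yx≈0 (sym (zeroˡ _)))

  nonZero-hasSize : HasSize (subsetoid setoid (λ s → ¬ s ≈ 0#)) t
  nonZero-hasSize = ≡.subst (HasSize _) #≡t
    (K.#-hasSize (λ x≈y x≉0 y≈0 → x≉0 (trans x≈y y≈0)) nonZero?)
    where
    nonZero? = λ s → ¬? (s ≈? 0#)
    #≡t : K.# nonZero? ≡ t
    #≡t = ℕ.suc-injective (≡.trans
      (cong (ℕ._+ K.# nonZero?) (≡.sym (K.#-singleton (_≈? 0#)
        (λ x → mk⇔ (λ x≈0 → x≈0) (λ x≈0 → x≈0)))))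
      (K.#-complement (_≈? 0#)))

  -- The first nonzero coordinate. It is homogeneous of degree 1 and vanishes only at the zero
  -- vector, so it is a canonical coordinate on every line through the origin and distinguishes one
  -- representative of each point.
  lead : ∀ {d} → Vector Carrier d → Carrier
  lead {zero}  u = 0#
  lead {suc d} u with u zero ≈? 0#
  ... | yes _ = lead (u ∘ suc)
  ... | no  _ = u zero

  lead-cong : ∀ {d} (u w : Vector Carrier d) → u ≋ w → lead u ≈ lead w
  lead-cong {zero}  u w u≋w = refl
  lead-cong {suc d} u w u≋w with u zero ≈? 0# | w zero ≈? 0#
  ... | yes _   | yes _   = lead-cong (u ∘ suc) (w ∘ suc) (u≋w ∘ suc)
  ... | no _    | no _    = u≋w zero
  ... | yes u≈0 | no w≉0  = contradiction (trans (sym (u≋w zero)) u≈0) w≉0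
  ... | no u≉0  | yes w≈0 = contradiction (trans (u≋w zero) w≈0) u≉0

  lead≈0⇒≋0 : ∀ {d} (u : Vector Carrier d) → lead u ≈ 0# → ∀ i → u i ≈ 0#
  lead≈0⇒≋0 {suc d} u lu≈0 with u zero ≈? 0#
  ... | no u≉0  = contradiction lu≈0 u≉0
  ... | yes u≈0 = λ { zero → u≈0 ; (suc i) → lead≈0⇒≋0 (u ∘ suc) lu≈0 i }

  ≋0⇒lead≈0 : ∀ {d} (u : Vector Carrier d) → (∀ i → u i ≈ 0#) → lead u ≈ 0#
  ≋0⇒lead≈0 {zero}  u u≋0 = refl
  ≋0⇒lead≈0 {suc d} u u≋0 with u zero ≈? 0#
  ... | yes _  = ≋0⇒lead≈0 (u ∘ suc) (u≋0 ∘ suc)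
  ... | no u≉0 = contradiction (u≋0 zero) u≉0

  lead-scale : ∀ {d} s (u : Vector Carrier d) → lead (λ i → s * u i) ≈ s * lead u
  lead-scale {zero}  s u = sym (zeroʳ s)
  lead-scale {suc d} s u with u zero ≈? 0# | s * u zero ≈? 0#
  ... | yes _   | yes _    = lead-scale s (u ∘ suc)
  ... | yes u≈0 | no su≉0  = contradiction (trans (*-congˡ u≈0) (zeroʳ s)) su≉0
  ... | no u≉0  | no _     = refl
  ... | no u≉0  | yes su≈0 = begin
    lead (λ i → s * u (suc i))  ≈⟨ ≋0⇒lead≈0 {d} _ (λ i → trans (*-congʳ s≈0) (zeroˡ _)) ⟩
    0#                          ≈⟨ su≈0 ⟨
    s * u zero                  ∎
    where s≈0 = *≈0⇒≈0 u≉0 su≈0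

  -- Subspaces and points of PG(N-1, q)

  module Geometry (N : ℕ) where
    open PG F N
    open RingProperties ring using (-1*x≈-x)
    open SemiringSum semiring using (sum-cong-≋)

    𝕍ₛ : Setoid _ _
    𝕍ₛ = ≋-setoid N

    opaque
      vectors-hasSize : HasSize 𝕍ₛ (suc t ^ N)
      vectors-hasSize = Vector-hasSize hF N

    private module V = Counting vectors-hasSize
    open V public using () renaming (_≈?_ to _≋?_)

    NonZero : Pred 𝕍 _
    NonZero u = ¬ u ≋ 0ᵛ

    ·ᵛ-cong : ∀ {r s} {u w : 𝕍} → r ≈ s → u ≋ w → r ·ᵛ u ≋ s ·ᵛ w
    ·ᵛ-cong r≈s u≋w i = *-cong r≈s (u≋w i)

    ·ᵛ-inverse : ∀ {r s} u → r * s ≈ 1# → r ·ᵛ (s ·ᵛ u) ≋ u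
    ·ᵛ-inverse {r} {s} u rs≈1 i = begin
      r * (s * u i)  ≈⟨ *-assoc r s (u i) ⟨
      r * s * u i    ≈⟨ *-congʳ rs≈1 ⟩
      1# * u i       ≈⟨ *-identityˡ (u i) ⟩
      u i            ∎

    +ᵛ-·ᵛ-cancel : ∀ {r s} u v → r + s ≈ 0# → (u +ᵛ r ·ᵛ v) +ᵛ s ·ᵛ v ≋ u
    +ᵛ-·ᵛ-cancel {r} {s} u v r+s≈0 i = begin
      u i + r * v i + s * v i    ≈⟨ +-assoc (u i) (r * v i) (s * v i) ⟩
      u i + (r * v i + s * v i)  ≈⟨ +-congˡ (distribʳ (v i) r s) ⟨
      u i + (r + s) * v i        ≈⟨ +-congˡ (*-congʳ r+s≈0) ⟩
      u i + 0# * v i             ≈⟨ +-congˡ (zeroˡ (v i)) ⟩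
      u i + 0#                   ≈⟨ +-identityʳ (u i) ⟩
      u i                        ∎

    lead-nonZero : ∀ {u} → NonZero u → ¬ lead u ≈ 0#
    lead-nonZero {u} u≉0 lu≈0 = u≉0 (lead≈0⇒≋0 u lu≈0)

    nonZero-lead : ∀ {u} → ¬ lead u ≈ 0# → NonZero u
    nonZero-lead {u} lu≉0 u≋0 = lu≉0 (≋0⇒lead≈0 u u≋0)

    ·ᵛ-nonZero : ∀ {s u} → NonZero (s ·ᵛ u) → ¬ s ≈ 0#
    ·ᵛ-nonZero su≉0 s≈0 = su≉0 λ i → trans (*-congʳ s≈0) (zeroˡ _)

    module _ (U : Subspace) where
      private module U = Subspace U

      ∈-undo-·ᵛ : ∀ {s u} → ¬ s ≈ 0# → Member U (s ·ᵛ u) → Member U u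
      ∈-undo-·ᵛ {s} {u} s≉0 su∈U with r , rs≈1 ← invert s s≉0 =
        U.resp (·ᵛ-inverse u rs≈1) (U.·-closed r su∈U)

      ∈-undo-+ᵛ : ∀ {u w} → Member U u → Member U (u +ᵛ w) → Member U w
      ∈-undo-+ᵛ {u} {w} u∈U u+w∈U =
        U.resp u+w-u≋w (U.+-closed u+w∈U (U.·-closed (- 1#) u∈U))
        where
        u+w-u≋w : (u +ᵛ w) +ᵛ (- 1#) ·ᵛ u ≋ w
        u+w-u≋w i = begin
          u i + w i + - 1# * u i    ≈⟨ +-cong (+-comm (u i) (w i)) (-1*x≈-x (u i)) ⟩
          w i + u i + - u i         ≈⟨ +-assoc (w i) (u i) (- u i) ⟩
          w i + (u i + - u i)       ≈⟨ +-congˡ (-‿inverseʳ (u i)) ⟩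
          w i + 0#                  ≈⟨ +-identityʳ (w i) ⟩
          w i                       ∎

      subspaceₛ : Setoid _ _
      subspaceₛ = subsetoid 𝕍ₛ (Member U)

      subspace-hasSize : HasSize subspaceₛ (V.# U.member?)
      subspace-hasSize = V.#-hasSize U.resp U.member?

    infixl 7 _⊓_
    _⊓_ : Subspace → Subspace → Subspace
    U ⊓ W = record
      { Member   = Member U ∩ Member W
      ; resp     = λ u≋w (∈U , ∈W) → U.resp u≋w ∈U , W.resp u≋w ∈W
      ; 0-closed = U.0-closed , W.0-closed
      ; +-closed = λ (u∈U , u∈W) (w∈U , w∈W) → U.+-closed u∈U w∈U , W.+-closed u∈W w∈W
      ; ·-closed = λ s (u∈U , u∈W) → U.·-closed s u∈U , W.·-closed s u∈W
      ; member?  = λ u → U.member? u ×-dec W.member? u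
      }
      where
      module U = Subspace U
      module W = Subspace W

    infix 5 _⊕⟨_⟩
    -- Membership has exactly the shape of the conclusion of `IsHyperplane`: H is a hyperplane when
    -- H ⊕⟨ v ⟩ is the whole space for every v outside H.
    _⊕⟨_⟩ : Subspace → 𝕍 → Subspace
    U ⊕⟨ v ⟩ = record
      { Member   = λ w → ∃[ s ] Member U (w +ᵛ s ·ᵛ v)
      ; resp     = λ u≋w (s , ∈U) → s , U.resp (λ i → +-congʳ (u≋w i)) ∈U
      ; 0-closed = 0# , U.resp (λ i → sym (trans (+-identityˡ _) (zeroˡ _))) U.0-closed
      ; +-closed = λ (r , ∈U) (s , ∈U′) → r + s , U.resp (λ i → regroup _ _ r s (v i)) (U.+-closed ∈U ∈U′)
      ; ·-closed = λ r (s , ∈U) → r * s , U.resp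
          (λ i → trans (distribˡ r _ _) (+-congˡ (sym (*-assoc r s (v i))))) (U.·-closed r ∈U)
      ; member?  = λ w → K.search (λ r≈s → U.resp λ i → +-congˡ (*-congʳ r≈s))
          (λ s → U.member? (w +ᵛ s ·ᵛ v))
      }
      where
      module U = Subspace U
      regroup : ∀ x y r s z → (x + r * z) + (y + s * z) ≈ (x + y) + (r + s) * z
      regroup x y r s z = begin
        (x + r * z) + (y + s * z)    ≈⟨ +-assoc x (r * z) (y + s * z) ⟩
        x + (r * z + (y + s * z))    ≈⟨ +-congˡ (+-assoc (r * z) y (s * z)) ⟨
        x + (r * z + y + s * z)      ≈⟨ +-congˡ (+-congʳ (+-comm (r * z) y)) ⟩
        x + (y + r * z + s * z)      ≈⟨ +-congˡ (+-assoc y (r * z) (s * z)) ⟩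
        x + (y + (r * z + s * z))    ≈⟨ +-assoc x y (r * z + s * z) ⟨
        x + y + (r * z + s * z)      ≈⟨ +-congˡ (distribʳ z r s) ⟨
        x + y + (r + s) * z          ∎

    span : 𝕍 → Subspace
    span v = record
      { Member   = λ w → ∃[ s ] s ·ᵛ v ≋ w
      ; resp     = λ u≋w (s , eq) → s , ≋-trans eq u≋w
      ; 0-closed = 0# , λ i → zeroˡ _
      ; +-closed = λ (r , eq) (s , eq′) → r + s , λ i → trans (distribʳ (v i) r s) (+-cong (eq i) (eq′ i))
      ; ·-closed = λ r (s , eq) → r * s , λ i → trans (*-assoc r s (v i)) (*-congˡ (eq i))
      ; member?  = λ w → K.search (λ r≈s eq → ≋-trans (·ᵛ-cong (sym r≈s) (λ i → refl)) eq)
          (λ s → s ·ᵛ v ≋? w)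
      }

    ∈-span : ∀ v → Member (span v) v
    ∈-span v = 1# , λ i → *-identityˡ (v i)

    span-⊆ : ∀ {v} U → Member U v → span v ⊆ˢ U
    span-⊆ U v∈U (s , sv≋w) = Subspace.resp U sv≋w (Subspace.·-closed U s v∈U)

    ⟨_,_⟩ : ∀ u → NonZero u → Point
    ⟨ u , u≉0 ⟩ = record
      { subspace = span u
      ; dim≡1    = record
        { basis       = λ _ → u
        ; members     = λ _ → ∈-span u
        ; independent = λ s su≋0 → λ { zero → *≈0⇒≈0 (lead-nonZero u≉0) (begin
            s zero * lead u          ≈⟨ lead-scale (s zero) u ⟨
            lead (s zero ·ᵛ u)       ≈⟨ ≋0⇒lead≈0 (s zero ·ᵛ u)
                                          (λ i → trans (sym (+-identityʳ _)) (su≋0 i)) ⟩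
            0#                       ∎) }
        ; spanning    = λ (s , su≋w) → (λ _ → s) , λ i → trans (+-identityʳ _) (su≋w i)
        }
      }

    generator : Point → 𝕍
    generator x = HasDim.basis (Point.dim≡1 x) zero

    generator-∈ : ∀ x → Member (subspace x) (generator x)
    generator-∈ x = HasDim.members (Point.dim≡1 x) zero

    generator-nonZero : ∀ x → NonZero (generator x)
    generator-nonZero x g≋0 = 1≉0 (HasDim.independent (Point.dim≡1 x) (λ _ → 1#)
      (λ i → trans (+-identityʳ _) (trans (*-identityˡ _) (g≋0 i))) zero)

    ∈⇒multiple : ∀ x {u} → Member (subspace x) u → ∃[ s ] s ·ᵛ generator x ≋ u
    ∈⇒multiple x u∈x with s , eq ← HasDim.spanning (Point.dim≡1 x) u∈x =
      s zero , λ i → trans (sym (+-identityʳ _)) (eq i)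

    generator-∈⇒⊆ : ∀ x U → Member U (generator x) → x ∈ˢ U
    generator-∈⇒⊆ x U g∈U u∈x with s , sg≋u ← ∈⇒multiple x u∈x =
      Subspace.resp U sg≋u (Subspace.·-closed U s g∈U)

    -- Each nonzero vector of a point is an invertible multiple of its generator; points are thus
    -- atoms of the subspace lattice.
    nonZero-∈⇒⊆ : ∀ x U {u} → NonZero u → Member (subspace x) u → Member U u → x ∈ˢ U
    nonZero-∈⇒⊆ x U {u} u≉0 u∈x u∈U with s , sg≋u ← ∈⇒multiple x u∈x =
      generator-∈⇒⊆ x U (∈-undo-·ᵛ U
        (·ᵛ-nonZero (λ sg≋0 → u≉0 (≋-trans (≋-sym sg≋u) sg≋0)))
        (Subspace.resp U (≋-sym sg≋u) u∈U))

    _∈ˢ?_ : ∀ x U → Dec (x ∈ˢ U)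
    x ∈ˢ? U = map′ (generator-∈⇒⊆ x U) (λ x∈U → x∈U (generator-∈ x))
      (Subspace.member? U (generator x))

    ∈ˢ-resp : ∀ U {x y} → Setoid._≈_ points x y → x ∈ˢ U → y ∈ˢ U
    ∈ˢ-resp U x≈y x∈U u∈y = x∈U (proj₂ x≈y u∈y)

    _≈ₚ_ : Point → Point → Set _
    _≈ₚ_ = Setoid._≈_ points

    ⊆⇒≈ₚ : ∀ x y → x ∈ˢ subspace y → x ≈ₚ y
    ⊆⇒≈ₚ x y x⊆y = x⊆y ,
      nonZero-∈⇒⊆ y (subspace x) (generator-nonZero x) (x⊆y (generator-∈ x)) (generator-∈ x)

    lead-injective : ∀ x {u w} → Member (subspace x) u → Member (subspace x) w →
      lead u ≈ lead w → u ≋ w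
    lead-injective x {u} {w} u∈x w∈x lu≈lw
      with r , rg≋u ← ∈⇒multiple x u∈x | s , sg≋w ← ∈⇒multiple x w∈x =
      ≋-trans (≋-sym rg≋u) (≋-trans (·ᵛ-cong r≈s (λ i → refl)) sg≋w)
      where
      g = generator x
      r≈s : r ≈ s
      r≈s = *-cancelʳ-nonZero (lead-nonZero (generator-nonZero x)) (begin
        r * lead g     ≈⟨ lead-scale r g ⟨
        lead (r ·ᵛ g)  ≈⟨ lead-cong _ _ rg≋u ⟩
        lead u         ≈⟨ lu≈lw ⟩
        lead w         ≈⟨ lead-cong _ _ sg≋w ⟨
        lead (s ·ᵛ g)  ≈⟨ lead-scale s g ⟩
        s * lead g     ∎)

    -- The representative with leading coordinate 1.
    normal : Point → 𝕍
    normal x = proj₁ (invert (lead (generator x)) (lead-nonZero (generator-nonZero x))) ·ᵛ generator x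

    normal-∈ : ∀ x → Member (subspace x) (normal x)
    normal-∈ x = Subspace.·-closed (subspace x) _ (generator-∈ x)

    lead-normal : ∀ x → lead (normal x) ≈ 1#
    lead-normal x = trans (lead-scale _ (generator x))
      (proj₂ (invert (lead (generator x)) (lead-nonZero (generator-nonZero x))))

    lead-·ᵛ-normal : ∀ s x → lead (s ·ᵛ normal x) ≈ s
    lead-·ᵛ-normal s x = begin
      lead (s ·ᵛ normal x)  ≈⟨ lead-scale s (normal x) ⟩
      s * lead (normal x)   ≈⟨ *-congˡ (lead-normal x) ⟩
      s * 1#                ≈⟨ *-identityʳ s ⟩
      s                     ∎

    ·ᵛ-normal-nonZero : ∀ x {s} → ¬ s ≈ 0# → NonZero (s ·ᵛ normal x)
    ·ᵛ-normal-nonZero x {s} s≉0 =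
      nonZero-lead λ l≈0 → s≉0 (trans (sym (lead-·ᵛ-normal s x)) l≈0)

    normal-cong : ∀ x y → x ≈ₚ y → normal x ≋ normal y
    normal-cong x y (x⊆y , _) = lead-injective y (x⊆y (normal-∈ x)) (normal-∈ y)
      (trans (lead-normal x) (sym (lead-normal y)))

    ⟨⟩-cong : ∀ {u w} u≉0 w≉0 → u ≋ w → ⟨ u , u≉0 ⟩ ≈ₚ ⟨ w , w≉0 ⟩
    ⟨⟩-cong {u} {w} u≉0 w≉0 u≋w = ⊆⇒≈ₚ ⟨ u , u≉0 ⟩ ⟨ w , w≉0 ⟩
      (span-⊆ (span w) (Subspace.resp (span w) (≋-sym u≋w) (∈-span w)))

    ∈⇒⟨⟩≈ : ∀ x {u} u≉0 → Member (subspace x) u → ⟨ u , u≉0 ⟩ ≈ₚ x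
    ∈⇒⟨⟩≈ x {u} u≉0 u∈x = ⊆⇒≈ₚ ⟨ u , u≉0 ⟩ x (span-⊆ (subspace x) u∈x)

    private
      lead≈1? : Decidable (λ (u : 𝕍) → lead u ≈ 1#)
      lead≈1? u = lead u ≈? 1#

      lead≈1⇒nonZero : ∀ {u} → lead u ≈ 1# → NonZero u
      lead≈1⇒nonZero lu≈1 = nonZero-lead λ lu≈0 → 1≉0 (trans (sym lu≈1) lu≈0)

    opaque
      -- Points correspond to their normal representatives. The count stays unevaluated here and
      -- serves to enumerate the points; `points-geometricSum` gives its value.
      points-hasSize : HasSize points (V.# lead≈1?)
      points-hasSize = hasSize-via
        (mkInverse points (subsetoid 𝕍ₛ (λ u → lead u ≈ 1#))
          (λ x → normal x , lead-normal x)
          (λ (u , lu≈1) → ⟨ u , lead≈1⇒nonZero lu≈1 ⟩)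
          normal-cong
          (λ (u , lu≈1) (w , lw≈1) → ⟨⟩-cong (lead≈1⇒nonZero lu≈1) (lead≈1⇒nonZero lw≈1))
          (λ (u , lu≈1) → lead-injective ⟨ u , lead≈1⇒nonZero lu≈1 ⟩
            (normal-∈ ⟨ u , lead≈1⇒nonZero lu≈1 ⟩) (∈-span u)
            (trans (lead-normal ⟨ u , lead≈1⇒nonZero lu≈1 ⟩) (sym lu≈1)))
          (λ x → ∈⇒⟨⟩≈ x (lead≈1⇒nonZero (lead-normal x)) (normal-∈ x)))
        (V.#-hasSize (λ u≋w lu≈1 → trans (lead-cong _ _ (≋-sym u≋w)) lu≈1) lead≈1?)

    module Points = Counting points-hasSize

    pointsOf : Subspace → ℕ
    pointsOf U = Points.# (_∈ˢ? U)

    private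
      -- Polar coordinates: a nonzero vector u is determined by the point ⟨u⟩ and the scalar
      -- `lead u`, with inverse (x, s) ↦ s · `normal x`.
      nonZero-∩-hasSize : ∀ U →
        HasSize (subsetoid 𝕍ₛ (NonZero ∩ Member U)) (pointsOf U ℕ.* t)
      nonZero-∩-hasSize U = hasSize-via
        (mkInverse (subsetoid 𝕍ₛ (NonZero ∩ Member U))
          (subsetoid points (_∈ˢ U) ×ₛ subsetoid setoid (λ s → ¬ s ≈ 0#))
          (λ (u , u≉0 , u∈U) → (⟨ u , u≉0 ⟩ , span-⊆ U u∈U) , (lead u , lead-nonZero u≉0))
          (λ ((x , x∈U) , (s , s≉0)) → s ·ᵛ normal x
            , ·ᵛ-normal-nonZero x s≉0
            , Subspace.·-closed U s (x∈U (normal-∈ x)))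
          (λ (u , u≉0 , _) (w , w≉0 , _) u≋w → ⟨⟩-cong u≉0 w≉0 u≋w , lead-cong u w u≋w)
          (λ ((x , _) , _) ((y , _) , _) (x≈y , r≈s) → ·ᵛ-cong r≈s (normal-cong x y x≈y))
          (λ ((x , _) , (s , s≉0)) →
            ∈⇒⟨⟩≈ x (·ᵛ-normal-nonZero x s≉0) (Subspace.·-closed (subspace x) s (normal-∈ x)) , lead-·ᵛ-normal s x)
          (λ (u , u≉0 , _) → lead-injective ⟨ u , u≉0 ⟩
            (Subspace.·-closed (span u) _ (normal-∈ ⟨ u , u≉0 ⟩)) (∈-span u)
            (lead-·ᵛ-normal (lead u) ⟨ u , u≉0 ⟩)))
        (×-hasSize (Points.#-hasSize (λ {x} {y} → ∈ˢ-resp U {x} {y}) (_∈ˢ? U)) nonZero-hasSize)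

    pointsOf-vectors : ∀ U {n} → HasSize (subspaceₛ U) n → pointsOf U ℕ.* t ℕ.+ 1 ≡ n
    pointsOf-vectors U {n} hU = E.begin
      pointsOf U ℕ.* t ℕ.+ 1                                  E.≡⟨ ℕ.+-comm (pointsOf U ℕ.* t) 1 ⟩
      1 ℕ.+ pointsOf U ℕ.* t                                  E.≡⟨ cong₂ ℕ._+_ #zero≡1 #nonZero≡ ⟨
      V.# (λ u → zero? u ×-dec U.member? u)
        ℕ.+ V.# (λ u → ¬? (zero? u) ×-dec U.member? u)        E.≡⟨ V.#-split zero? U.member? ⟩
      V.# U.member?                                           E.≡⟨ hasSize-unique (subspace-hasSize U) hU ⟩
      n                                                       E.∎
      where
      module E = ≡.≡-Reasoning
      module U = Subspace U
      zero? = λ u → u ≋? 0ᵛ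
      #zero≡1 : V.# (λ u → zero? u ×-dec U.member? u) ≡ 1
      #zero≡1 = V.#-singleton (λ u → zero? u ×-dec U.member? u) λ u →
        mk⇔ proj₁ (λ u≋0 → u≋0 , U.resp (≋-sym u≋0) U.0-closed)
      #nonZero≡ : V.# (λ u → ¬? (zero? u) ×-dec U.member? u) ≡ pointsOf U ℕ.* t
      #nonZero≡ = hasSize-unique
        (V.#-hasSize (λ u≋w (u≉0 , u∈U) → (λ w≋0 → u≉0 (≋-trans u≋w w≋0)) , U.resp u≋w u∈U)
          (λ u → ¬? (zero? u) ×-dec U.member? u))
        (nonZero-∩-hasSize U)

    -- The hypothesis is a size instead of a `HasDim`, so that it applies to sections for which no
    -- basis has been constructed.
    pointsOf-dim : ∀ U d → HasSize (subspaceₛ U) (suc t ^ d) → pointsOf U ≡ geometricSum t d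
    pointsOf-dim U d hU = ℕ.*-cancelʳ-≡ _ _ t (ℕ.+-cancelʳ-≡ 1 _ _
      (≡.trans (pointsOf-vectors U hU) (≡.sym (geometricSum-closed t d))))

    -- Bases, hyperplanes and sizes of sections

    lincomb-cong : ∀ {d} (r s : Vector Carrier d) u → r ≋ s → lincomb r u ≋ lincomb s u
    lincomb-cong {d} r s u r≋s i = sum-cong-≋ {d} λ j → *-congʳ (r≋s j)

    lincomb-∈ : ∀ U {d} (s : Vector Carrier d) u → (∀ j → Member U (u j)) → Member U (lincomb s u)
    lincomb-∈ U {zero}  s u u∈U = Subspace.0-closed U
    lincomb-∈ U {suc d} s u u∈U = Subspace.+-closed U (Subspace.·-closed U (s zero) (u∈U zero))
      (lincomb-∈ U (s ∘ suc) (u ∘ suc) (u∈U ∘ suc))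

    lincomb-linear : ∀ {d} (r s : Vector Carrier d) k u →
      lincomb (λ j → r j + k * s j) u ≋ lincomb r u +ᵛ k ·ᵛ lincomb s u
    lincomb-linear {zero}  r s k u i = sym (trans (+-identityˡ _) (zeroʳ k))
    lincomb-linear {suc d} r s k u i = begin
      (r zero + k * s zero) * u zero i + lincomb (λ j → r (suc j) + k * s (suc j)) (u ∘ suc) i
        ≈⟨ +-cong (trans (distribʳ _ _ _) (+-congˡ (*-assoc k _ _)))
                  (lincomb-linear (r ∘ suc) (s ∘ suc) k (u ∘ suc) i) ⟩
      (x + k * y) + (X + k * Y)    ≈⟨ +-assoc x (k * y) (X + k * Y) ⟩
      x + (k * y + (X + k * Y))    ≈⟨ +-congˡ (+-assoc (k * y) X (k * Y)) ⟨
      x + (k * y + X + k * Y)      ≈⟨ +-congˡ (+-congʳ (+-comm (k * y) X)) ⟩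
      x + (X + k * y + k * Y)      ≈⟨ +-congˡ (+-assoc X (k * y) (k * Y)) ⟩
      x + (X + (k * y + k * Y))    ≈⟨ +-assoc x X _ ⟨
      x + X + (k * y + k * Y)      ≈⟨ +-congˡ (distribˡ k y Y) ⟨
      x + X + k * (y + Y)          ∎
      where
      x = r zero * u zero i
      y = s zero * u zero i
      X = lincomb (r ∘ suc) (u ∘ suc) i
      Y = lincomb (s ∘ suc) (u ∘ suc) i

    dim-hasSize : ∀ U {d} → HasDim U d → HasSize (subspaceₛ U) (suc t ^ d)
    dim-hasSize U {d} hasDim = hasSize-via
      (mkInverse (subspaceₛ U) (≋-setoid d)
        (λ (u , u∈U) → proj₁ (D.spanning u∈U))
        (λ s → lincomb s D.basis , lincomb-∈ U s D.basis D.members)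
        (λ (u , u∈U) (w , w∈U) u≋w → lincomb-injective _ _
          (≋-trans (proj₂ (D.spanning u∈U)) (≋-trans u≋w (≋-sym (proj₂ (D.spanning w∈U))))))
        (λ r s → lincomb-cong r s D.basis)
        (λ s → lincomb-injective _ s (proj₂ (D.spanning (lincomb-∈ U s D.basis D.members))))
        (λ (u , u∈U) → proj₂ (D.spanning u∈U)))
      (Vector-hasSize hF d)
      where
      module D = HasDim hasDim
      lincomb-injective : ∀ r s → lincomb r D.basis ≋ lincomb s D.basis → r ≋ s
      lincomb-injective r s eq j = begin
        r j                             ≈⟨ +-identityʳ (r j) ⟨
        r j + 0#                        ≈⟨ +-congˡ (-‿inverseˡ (s j)) ⟨
        r j + (- s j + s j)             ≈⟨ +-assoc (r j) (- s j) (s j) ⟨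
        r j + - s j + s j               ≈⟨ +-congʳ (+-congˡ (-1*x≈-x (s j))) ⟨
        r j + - 1# * s j + s j          ≈⟨ +-congʳ (D.independent _ difference≋0 j) ⟩
        0# + s j                        ≈⟨ +-identityˡ (s j) ⟩
        s j                             ∎
        where
        difference≋0 : lincomb (λ j → r j + - 1# * s j) D.basis ≋ 0ᵛ
        difference≋0 i = begin
          lincomb (λ j → r j + - 1# * s j) D.basis i             ≈⟨ lincomb-linear r s (- 1#) D.basis i ⟩
          lincomb r D.basis i + - 1# * lincomb s D.basis i       ≈⟨ +-cong (eq i) (-1*x≈-x _) ⟩
          lincomb s D.basis i + - lincomb s D.basis i            ≈⟨ -‿inverseʳ _ ⟩
          0#                                                     ∎

    -- Maximality in elementwise form. The whole space satisfies it vacuously; properness enters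
    -- below as the condition that W does not lie in H.
    IsHyperplane : Subspace → Set _
    IsHyperplane H = ∀ v → ¬ Member H v → ∀ w → ∃[ s ] Member H (w +ᵛ s ·ᵛ v)

    -- Fix v in W outside H. Each w in W has exactly one scalar s with w + s v in H, so w ↦ (s, w +
    -- s v) is a bijection from W to F × (W ∩ H).
    hyperplane-section : ∀ H → IsHyperplane H → ∀ W → ¬ (W ⊆ˢ H) → ∀ {m n} →
      HasSize (subspaceₛ W) m → HasSize (subspaceₛ (W ⊓ H)) n → m ≡ suc t ℕ.* n
    hyperplane-section H hyper W W⊈H hW hW⊓H
      with V.search (λ u≋w (u∈W , u∉H) → Subspace.resp W u≋w u∈W , u∉H ∘ Subspace.resp H (≋-sym u≋w))
             (λ u → Subspace.member? W u ×-dec ¬? (Subspace.member? H u))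
    ... | no none = contradiction
            (λ {u} u∈W → decidable-stable (Subspace.member? H u) (λ u∉H → none (u , u∈W , u∉H))) W⊈H
    ... | yes (v , v∈W , v∉H) = hasSize-unique hW (hasSize-via
      (mkInverse (subspaceₛ W) (setoid ×ₛ subspaceₛ (W ⊓ H))
        (λ (w , w∈W) → coefficient w , w +ᵛ coefficient w ·ᵛ v
          , W.+-closed w∈W (W.·-closed _ v∈W) , proj₂ (hyper v v∉H w))
        (λ (s , h , h∈W , _) → h +ᵛ (- s) ·ᵛ v , W.+-closed h∈W (W.·-closed _ v∈W))
        (λ (u , _) (w , _) u≋w → let eq = unique u≋w (proj₂ (hyper v v∉H u)) (proj₂ (hyper v v∉H w))
          in eq , λ i → +-cong (u≋w i) (*-congʳ eq))
        (λ (r , _) (s , _) (r≈s , g≋h) i → +-cong (g≋h i) (*-congʳ (-‿cong r≈s)))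
        (λ (s , h , _ , h∈H) → let
            w = h +ᵛ (- s) ·ᵛ v
            w+sv≋h = +ᵛ-·ᵛ-cancel h v (-‿inverseˡ s)
            eq = unique {w} (λ i → refl) (proj₂ (hyper v v∉H w)) (H.resp (≋-sym w+sv≋h) h∈H)
          in eq , ≋-trans (λ i → +-congˡ (*-congʳ eq)) w+sv≋h)
        (λ (w , _) → +ᵛ-·ᵛ-cancel w v (-‿inverseʳ (coefficient w))))
      (×-hasSize hF hW⊓H))
      where
      module H = Subspace H
      module W = Subspace W
      coefficient : 𝕍 → Carrier
      coefficient w = proj₁ (hyper v v∉H w)
      unique : ∀ {u w r s} → u ≋ w → Member H (u +ᵛ r ·ᵛ v) → Member H (w +ᵛ s ·ᵛ v) → r ≈ s
      unique {u} {w} {r} {s} u≋w u+rv∈H w+sv∈H with r ≈? s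
      ... | yes r≈s = r≈s
      -- Two different scalars would give two vectors of H differing by (s - r) v, which puts v in
      -- H.
      ... | no r≉s  = contradiction (∈-undo-·ᵛ H s-r≉0 (∈-undo-+ᵛ H u+rv∈H (H.resp shift w+sv∈H))) v∉H
        where
        s-r≉0 : ¬ s + - r ≈ 0#
        s-r≉0 s-r≈0 = r≉s (begin
          r                ≈⟨ +-identityˡ r ⟨
          0# + r           ≈⟨ +-congʳ s-r≈0 ⟨
          s + - r + r      ≈⟨ +-assoc s (- r) r ⟩
          s + (- r + r)    ≈⟨ +-congˡ (-‿inverseˡ r) ⟩
          s + 0#           ≈⟨ +-identityʳ s ⟩
          s                ∎)
        shift : w +ᵛ s ·ᵛ v ≋ (u +ᵛ r ·ᵛ v) +ᵛ (s + - r) ·ᵛ v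
        shift i = begin
          w i + s * v i                        ≈⟨ +-cong (u≋w i) (*-congʳ r+[s-r]≈s) ⟨
          u i + (r + (s + - r)) * v i          ≈⟨ +-congˡ (distribʳ (v i) r (s + - r)) ⟩
          u i + (r * v i + (s + - r) * v i)    ≈⟨ +-assoc (u i) _ _ ⟨
          u i + r * v i + (s + - r) * v i      ∎
          where
          r+[s-r]≈s : r + (s + - r) ≈ s
          r+[s-r]≈s = begin
            r + (s + - r)  ≈⟨ +-comm r (s + - r) ⟩
            s + - r + r    ≈⟨ +-assoc s (- r) r ⟩
            s + (- r + r)  ≈⟨ +-congˡ (-‿inverseˡ r) ⟩
            s + 0#         ≈⟨ +-identityʳ s ⟩
            s              ∎

    section-dim : ∀ H → IsHyperplane H → ∀ W → ¬ (W ⊆ˢ H) → ∀ d →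
      HasSize (subspaceₛ W) (suc t ^ suc d) → HasSize (subspaceₛ (W ⊓ H)) (suc t ^ d)
    section-dim H hyper W W⊈H d hW = ≡.subst (HasSize (subspaceₛ (W ⊓ H)))
      (≡.sym (ℕ.*-cancelˡ-≡ (suc t ^ d) _ (suc t)
        (hyperplane-section H hyper W W⊈H hW (subspace-hasSize (W ⊓ H)))))
      (subspace-hasSize (W ⊓ H))

    fullSpace : Subspace
    fullSpace = record
      { Member   = λ _ → Lift _ ⊤
      ; resp     = λ _ _ → lift tt
      ; 0-closed = lift tt
      ; +-closed = λ _ _ → lift tt
      ; ·-closed = λ _ _ → lift tt
      ; member?  = λ _ → yes (lift tt)
      }

    fullSpace-hasSize : HasSize (subspaceₛ fullSpace) (suc t ^ N)
    fullSpace-hasSize = hasSize-via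
      (mkInverse (subspaceₛ fullSpace) 𝕍ₛ proj₁ (λ u → u , lift tt)
        (λ _ _ u≋w → u≋w) (λ _ _ u≋w → u≋w) (λ _ _ → refl) (λ _ _ → refl))
      vectors-hasSize

    -- Polars of points

    module _ (Z : SymplecticPolarity) where
      open SymplecticPolarity Z

      ζ-antitone′ : ∀ U W → U ⊆ˢ ζ W → W ⊆ˢ ζ U
      ζ-antitone′ U W U⊆ζW w∈W = antitone U (ζ W) U⊆ζW (proj₂ (involutive W) w∈W)

      ζ-reflects : ∀ U W → ζ W ⊆ˢ ζ U → U ⊆ˢ W
      ζ-reflects U W ζW⊆ζU u∈U = proj₁ (involutive W)
        (antitone (ζ W) (ζ U) ζW⊆ζU (proj₂ (involutive U) u∈U))

      -- The subspace x^ζ + ⟨ v ⟩ is ζ of a subspace of x, and x has only two subspaces.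
      ζ-hyperplane : ∀ x → IsHyperplane (x ^ζ)
      ζ-hyperplane x v v∉H w with Subspace.member? (ζ (x ^ζ ⊕⟨ v ⟩)) (generator x)
      ... | yes g∈ζK = contradiction (K⊆H v∈K) v∉H
        where
        K = x ^ζ ⊕⟨ v ⟩
        K⊆H : K ⊆ˢ x ^ζ
        K⊆H = ζ-antitone′ (subspace x) K (generator-∈⇒⊆ x (ζ K) g∈ζK)
        v∈K : Member K v
        v∈K = - 1# , Subspace.resp (x ^ζ)
          (λ i → sym (trans (+-congˡ (-1*x≈-x (v i))) (-‿inverseʳ (v i))))
          (Subspace.0-closed (x ^ζ))
      -- `ζ K` lies in the atom x and misses its generator, so it is the zero subspace and lies in
      -- ζ⟨w⟩; reflecting this inclusion puts w in K.
      ... | no g∉ζK = ζ-reflects (span w) K ζK⊆ζ⟨w⟩ (∈-span w)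
        where
        K = x ^ζ ⊕⟨ v ⟩
        H⊆K : x ^ζ ⊆ˢ K
        H⊆K h∈H = 0# , Subspace.resp (x ^ζ)
          (λ i → sym (trans (+-congˡ (zeroˡ (v i))) (+-identityʳ _))) h∈H
        ζK⊆x : ζ K ⊆ˢ subspace x
        ζK⊆x u∈ζK = proj₁ (involutive (subspace x)) (antitone (x ^ζ) K H⊆K u∈ζK)
        ζK⊆ζ⟨w⟩ : ζ K ⊆ˢ ζ (span w)
        ζK⊆ζ⟨w⟩ {u} u∈ζK with u ≋? 0ᵛ
        ... | yes u≋0 = Subspace.resp (ζ (span w)) (≋-sym u≋0) (Subspace.0-closed (ζ (span w)))
        ... | no u≉0  = contradiction
                (nonZero-∈⇒⊆ x (ζ K) u≉0 (ζK⊆x u∈ζK) u∈ζK (generator-∈ x)) g∉ζK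

      -- Here `span 0ᵛ` serves as the zero subspace: a full polar would contain its ζ, and
      -- reflection would put x inside it.
      ζ-proper : ∀ x → ¬ (∀ v → Member (x ^ζ) v)
      ζ-proper x full with s , s0≋g ← ζ-reflects (subspace x) (span 0ᵛ) (λ {u} _ → full u) (generator-∈ x) =
        generator-nonZero x (≋-trans (≋-sym s0≋g) (λ i → zeroʳ s))

      ζ-injective : ∀ x y → x ^ζ ⊆ˢ y ^ζ → x ≈ₚ y
      ζ-injective x y x^ζ⊆y^ζ = Product.swap (⊆⇒≈ₚ y x (ζ-reflects (subspace y) (subspace x) x^ζ⊆y^ζ))

-- Symplectic spreads

open import Data.Nat.Base using (_+_; _*_; _∸_; _/_; _≤_)

≢⇔≡opposite : (i j : Fin 2) → i ≢ j ⇔ j ≡ opposite i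
≢⇔≡opposite zero       zero       = mk⇔ (contradiction ≡.refl) λ ()
≢⇔≡opposite zero       (suc zero) = mk⇔ (λ _ → ≡.refl) (λ _ ())
≢⇔≡opposite (suc zero) zero       = mk⇔ (λ _ → ≡.refl) (λ _ ())
≢⇔≡opposite (suc zero) (suc zero) = mk⇔ (contradiction ≡.refl) λ ()

module Spreads (F : HeytingField c ℓ₁ ℓ₂) {t : ℕ} .{{_ : ℕ.NonZero t}}
  (hF : HasSize (HeytingField-setoid F) (suc t)) (d : ℕ) where

  private
    -- With d = e - 1, the powers q^(e-1) and q^(2e-2) of the theorem become q^d and q^(2d).
    e = suc d
    N = 2 * e
    q = suc t
    G = geometricSum t

  open PG F N
  open FiniteField F hF
  open Geometry N
  open VecEq (HeytingField-setoid F) using (_≋_)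

  module Spread (Z : SymplecticPolarity) {R : Pred Subspace r} (S : IsSymplecticSpread Z e R) where
    open SymplecticPolarity Z
    private module S = IsSymplecticSpread S

    private
      -- `N` normalises to `suc (d + suc (d + 0))`, so the left side is the exponent N - 1 of a
      -- hyperplane.
      2d+1 : d + suc (d + 0) ≡ suc (2 * d)
      2d+1 = ℕ.+-suc d (d + 0)

    ^ζ-hasSize : ∀ x → HasSize (subspaceₛ (x ^ζ)) (q ^ suc (2 * d))
    ^ζ-hasSize x = ≡.subst (HasSize (subspaceₛ (x ^ζ)) ∘ (q ^_)) 2d+1 (hasSize-via
      (mkInverse (subspaceₛ (x ^ζ)) (subspaceₛ (fullSpace ⊓ (x ^ζ)))
        (λ (u , u∈) → u , _ , u∈) (λ (u , _ , u∈) → u , u∈)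
        (λ _ _ u≋w → u≋w) (λ _ _ u≋w → u≋w)
        (λ (u , _) → Setoid.refl 𝕍ₛ {u}) (λ (u , _) → Setoid.refl 𝕍ₛ {u}))
      (section-dim (x ^ζ) (ζ-hyperplane Z x) fullSpace
        (λ full⊆ → ζ-proper Z x λ v → full⊆ {v} _) (d + suc (d + 0)) fullSpace-hasSize))

    pointsOf-^ζ : ∀ x → pointsOf (x ^ζ) ≡ G (2 * d) + q ^ (2 * d)
    pointsOf-^ζ x = pointsOf-dim (x ^ζ) (suc (2 * d)) (^ζ-hasSize x)

    -- An inclusion between two polars makes the points equal, so for distinct points y^ζ cuts x^ζ
    -- in a proper section.
    pointsOf-^ζ-⊓ : ∀ x y → ¬ x ≈ₚ y → pointsOf (x ^ζ ⊓ y ^ζ) ≡ G (2 * d)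
    pointsOf-^ζ-⊓ x y x≉y = pointsOf-dim (x ^ζ ⊓ y ^ζ) (2 * d)
      (section-dim (y ^ζ) (ζ-hyperplane Z y) (x ^ζ) (x≉y ∘ ζ-injective Z x y) (2 * d) (^ζ-hasSize x))

    member-hasSize : ∀ {U} → R U → HasSize (subspaceₛ U) (q ^ e)
    member-hasSize {U} RU = dim-hasSize U (S.dim RU)

    -- Isotropy gives U ⊆ ζ U, and antitonicity applied to x ⊆ U gives ζ U ⊆ x^ζ.
    ∈⇒⊆^ζ : ∀ x {U} → R U → x ∈ˢ U → U ⊆ˢ x ^ζ
    ∈⇒⊆^ζ x {U} RU x∈U u∈U = antitone (subspace x) U x∈U (S.isotropic RU u∈U)

    -- Two members U ∋ x and W in x^ζ would give q^e * q^e distinct sums u + w in x^ζ.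
    ∉⇒⊈^ζ : ∀ x {W} → R W → ¬ x ∈ˢ W → ¬ W ⊆ˢ x ^ζ
    ∉⇒⊈^ζ x {W} RW x∉W W⊆x^ζ with U , RU , x∈U ← S.cover x =
      ℕ.<⇒≱ (ℕ.^-monoʳ-< q (s≤s (ℕ.>-nonZero⁻¹ t)) (ℕ.n<1+n (suc (2 * d))))
        (≡.subst (_≤ q ^ suc (2 * d)) q^e*q^e≡ (hasSize-≤
          (×-hasSize (member-hasSize RU) (member-hasSize RW)) (^ζ-hasSize x)
          (record
            { to   = λ ((u , u∈U) , (w , w∈W)) → u +ᵛ w
              , Subspace.+-closed (x ^ζ) (∈⇒⊆^ζ x RU x∈U u∈U) (W⊆x^ζ w∈W)
            ; cong = λ (u≋u′ , w≋w′) i → K.+-cong (u≋u′ i) (w≋w′ i)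
            })
          (λ ((u , u∈U) , (w , w∈W)) ((u′ , u′∈U) , (w′ , w′∈W)) eq →
            sum-injective {u} {w} {u′} {w′} u∈U w∈W u′∈U w′∈W eq)))
      where
      module K = CommutativeRing
        (HeytingCommutativeRing.commutativeRing (HeytingField.heytingCommutativeRing F))
      q^e*q^e≡ : q ^ e * q ^ e ≡ q ^ suc (suc (2 * d))
      q^e*q^e≡ = ≡.trans (≡.sym (ℕ.^-distribˡ-+-* q e e))
        (cong (q ^_) (cong suc (≡.trans (ℕ.+-suc d d) (cong (λ k → suc (d + k)) (≡.sym (ℕ.+-identityʳ d))))))
      meet-trivial : ∀ {v} → Member U v → Member W v → v ≋ 0ᵛ
      meet-trivial {v} v∈U v∈W with v ≋? 0ᵛ
      ... | yes v≋0 = v≋0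
      -- A nonzero common vector spans a point of both members, which forces U = W and puts x in W.
      ... | no v≉0  = contradiction
        (λ {u} u∈x → proj₁ (S.disjoint ⟨ v , v≉0 ⟩ RU RW (span-⊆ U v∈U) (span-⊆ W v∈W)) (x∈U u∈x)) x∉W
      sum-injective : ∀ {u w u′ w′} → Member U u → Member W w → Member U u′ → Member W w′ →
        u +ᵛ w ≋ u′ +ᵛ w′ →
        u ≋ u′ × w ≋ w′
      sum-injective {u} {w} {u′} {w′} u∈U w∈W u′∈U w′∈W eq = u≋u′ , w≋w′
        where
        open RingProperties K.ring using (-1*x≈-x; +-cancelˡ)
        open SetoidReasoning K.setoid
        -- As w′ - w, this vector lies in W; by the equation it is also u - u′ and lies in U.
        δ = w′ +ᵛ (K.- K.1#) ·ᵛ w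
        u≋u′+δ : u ≋ u′ +ᵛ δ
        u≋u′+δ i = begin
          u i                                      ≈⟨ K.+-identityʳ (u i) ⟨
          u i K.+ K.0#                             ≈⟨ K.+-congˡ (K.-‿inverseʳ (w i)) ⟨
          u i K.+ (w i K.+ K.- w i)                ≈⟨ K.+-assoc _ _ _ ⟨
          u i K.+ w i K.+ K.- w i                  ≈⟨ K.+-cong (eq i) (K.sym (-1*x≈-x (w i))) ⟩
          u′ i K.+ w′ i K.+ K.- K.1# K.* w i       ≈⟨ K.+-assoc _ _ _ ⟩
          u′ i K.+ (w′ i K.+ K.- K.1# K.* w i)     ∎
        δ≋0 : δ ≋ 0ᵛ
        δ≋0 = meet-trivial
          (∈-undo-+ᵛ U u′∈U (Subspace.resp U u≋u′+δ u∈U))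
          (Subspace.+-closed W w′∈W (Subspace.·-closed W (K.- K.1#) w∈W))
        u≋u′ : u ≋ u′
        u≋u′ i = K.trans (u≋u′+δ i) (K.trans (K.+-congˡ (δ≋0 i)) (K.+-identityʳ (u′ i)))
        w≋w′ : w ≋ w′
        w≋w′ i = +-cancelˡ (u i) (w i) (w′ i) (K.trans (eq i) (K.+-congʳ (K.sym (u≋u′ i))))

    pointsOf-∈ : ∀ x {U} → R U → x ∈ˢ U → pointsOf (U ⊓ x ^ζ) ≡ G e
    pointsOf-∈ x {U} RU x∈U = ≡.trans
      (Points.#-cong (_∈ˢ? (U ⊓ x ^ζ)) (_∈ˢ? U) λ z →
        mk⇔ (λ z∈ {u} u∈z → proj₁ (z∈ u∈z)) (λ z∈U {u} u∈z → z∈U u∈z , ∈⇒⊆^ζ x RU x∈U (z∈U u∈z)))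
      (pointsOf-dim U e (member-hasSize RU))

    pointsOf-∉ : ∀ x {W} → R W → ¬ x ∈ˢ W → pointsOf (W ⊓ x ^ζ) ≡ G d
    pointsOf-∉ x {W} RW x∉W = pointsOf-dim (W ⊓ x ^ζ) d
      (section-dim (x ^ζ) (ζ-hyperplane Z x) W (∉⇒⊈^ζ x RW x∉W) d (member-hasSize RW))

    -- Degrees and common neighbours in the modified graph

    module Bipartition (V : Partition points 2) {M : ℕ}
      (union : ∀ i → IsUnionOf M R (Class V i)) where

      Γ′ = complementWithinClasses (symplecticGraph Z) V
      open Graph Γ′ using (_~_; ~-resp)

      private
        cl = classOf V
        module Union (i : Fin 2) = IsUnionOf (union i)

      part-unique : ∀ i z j k → z ∈ˢ Union.part i j → z ∈ˢ Union.part i k → j ≡ k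
      part-unique i z j k z∈j z∈k = Union.distinct i
        (S.disjoint z (Union.part∈R i j) (Union.part∈R i k) z∈j z∈k)

      in? : ∀ i → Decidable (Class V i)
      in? i z = cl z Fin.≟ i

      #-class : ∀ i → Points.# (in? i) ≡ M * G e
      #-class i = ≡.trans
        (Points.#-∃ (in? i) (λ j z → z ∈ˢ? Union.part i j) (Union.union i) (part-unique i))
        (sum-const (G e) _ λ j →
          pointsOf-dim (Union.part i j) e (member-hasSize (Union.part∈R i j)))

      #-class-∩-^ζ : ∀ i x → Points.# (λ z → in? i z ×-dec z ∈ˢ? (x ^ζ))
                   ≡ sum (λ j → pointsOf (Union.part i j ⊓ x ^ζ))
      #-class-∩-^ζ i x = Points.#-∃ (λ z → in? i z ×-dec z ∈ˢ? (x ^ζ))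
        (λ j z → z ∈ˢ? (Union.part i j ⊓ x ^ζ))
        (λ z → mk⇔
          (λ (z∈i , z∈x^ζ) → Product.map₂ (λ z∈j {u} u∈z → z∈j u∈z , z∈x^ζ u∈z)
                               (Equivalence.to (Union.union i z) z∈i))
          (λ (j , z∈) → Equivalence.from (Union.union i z) (j , λ {u} u∈z → proj₁ (z∈ u∈z))
                      , λ {u} u∈z → proj₂ (z∈ u∈z)))
        (λ z j k z∈j z∈k → part-unique i z j k (λ {u} u∈z → proj₁ (z∈j u∈z)) (λ {u} u∈z → proj₁ (z∈k u∈z)))

      #-own-class : ∀ i x → cl x ≡ i →
        Points.# (λ z → in? i z ×-dec z ∈ˢ? (x ^ζ)) ≡ M * G d + q ^ d
      #-own-class i x x∈i with j , x∈j ← Equivalence.to (Union.union i x) x∈i = ≡.trans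
        (#-class-∩-^ζ i x)
        (sum-const-but-one (G d) (q ^ d) _ j (pointsOf-∈ x (Union.part∈R i j) x∈j)
          λ k k≢j → pointsOf-∉ x (Union.part∈R i k) λ x∈k → k≢j (part-unique i x k j x∈k x∈j))

      #-other-class : ∀ i x → cl x ≢ i →
        Points.# (λ z → in? i z ×-dec z ∈ˢ? (x ^ζ)) ≡ M * G d
      #-other-class i x x∉i = ≡.trans
        (#-class-∩-^ζ i x)
        (sum-const (G d) _ λ k → pointsOf-∉ x (Union.part∈R i k)
          λ x∈k → x∉i (Equivalence.from (Union.union i x) (k , x∈k)))

      #-class-complement : ∀ i x → cl x ≡ i →
        Points.# (λ z → ¬? (in? i z) ×-dec z ∈ˢ? (x ^ζ)) ≡ M * G d
      #-class-complement i x x∈i = ≡.trans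
        (Points.#-cong (λ z → ¬? (in? i z) ×-dec z ∈ˢ? (x ^ζ))
          (λ z → in? (opposite i) z ×-dec z ∈ˢ? (x ^ζ))
          λ z → mk⇔ (Product.map₁ (λ z∉i → Equivalence.to (≢⇔≡opposite i (cl z)) (z∉i ∘ ≡.sym)))
                    (Product.map₁ (λ z∈ → Equivalence.from (≢⇔≡opposite i (cl z)) z∈ ∘ ≡.sym)))
        (#-other-class (opposite i) x λ x∈ →
          Equivalence.from (≢⇔≡opposite i (cl x)) x∈ (≡.sym x∈i))

      -- The set x^ζ is the disjoint union of V₁ ∩ x^ζ and V₂ ∩ x^ζ.
      balance : Point → M * G d + M * G d + q ^ d ≡ G (2 * d) + q ^ (2 * d)
      balance x = begin
        m + m + q ^ d    ≡⟨ ℕ.+-assoc m m (q ^ d) ⟩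
        m + (m + q ^ d)  ≡⟨ ℕ.+-comm m (m + q ^ d) ⟩
        m + q ^ d + m    ≡⟨ cong₂ _+_ (#-own-class (cl x) x ≡.refl)
                                      (#-class-complement (cl x) x ≡.refl) ⟨
        _                ≡⟨ Points.#-split (in? (cl x)) (_∈ˢ? (x ^ζ)) ⟩
        pointsOf (x ^ζ)  ≡⟨ pointsOf-^ζ x ⟩
        G (2 * d) + q ^ (2 * d) ∎
        where
        open ≡.≡-Reasoning
        m = M * G d

      -- Since x lies both in its own class and in x^ζ, the exclusive or already excludes z = x, so
      -- the distinctness clauses of the two adjacencies vanish. The proposition D allows the class
      -- condition to be written relative to the class of another vertex.
      ~⇔⊻ : ∀ x z {D : Set} → (cl x ≡ cl z) ⇔ D → x ~ z ⇔ D ⊻ (z ∈ˢ x ^ζ)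
      ~⇔⊻ x z {D} ≡⇔D = mk⇔ to from
        where
        open Equivalence ≡⇔D using () renaming (to to ≡⇒D; from to D⇒≡)
        to : x ~ z → D ⊻ (z ∈ˢ x ^ζ)
        to (inj₁ (c≡ , x≉z , x≁z)) = inj₁ (≡⇒D c≡ , λ z∈x^ζ → x≁z (x≉z , z∈x^ζ))
        to (inj₂ (c≢ , _ , z∈x^ζ)) = inj₂ (c≢ ∘ D⇒≡ , z∈x^ζ)
        from : D ⊻ (z ∈ˢ x ^ζ) → x ~ z
        from (inj₁ (D , z∉x^ζ))  = inj₁
          (D⇒≡ D , (λ x≈z → z∉x^ζ (∈ˢ-resp (x ^ζ) {x} {z} x≈z (symplectic x))) , z∉x^ζ ∘ proj₂)
        from (inj₂ (¬D , z∈x^ζ)) = inj₂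
          (¬D ∘ ≡⇒D , (λ x≈z → ¬D (≡⇒D (Func.cong V x≈z))) , z∈x^ζ)

      private
        sym⇔ : ∀ {i j : Fin 2} → (i ≡ j) ⇔ (j ≡ i)
        sym⇔ = mk⇔ ≡.sym ≡.sym

      -- The polar has m + q^d points in the class of x and m outside it, where m = M G(d); the two
      -- occurrences of m cancel.
      degree : ∀ x → ∃[ k ] HasSize (subsetoid points (x ~_)) k × k + q ^ d ≡ M * G e
      degree x = _ , Points.#-hasSize-⇔ (λ {y} {z} → proj₁ ~-resp {x} {y} {z}) adjacent?
          (λ z → ~⇔⊻ x z sym⇔) , (begin
        k + q ^ d                ≡⟨ ℕ.+-cancelʳ-≡ m _ _ (begin
          k + q ^ d + m            ≡⟨ ℕ.+-assoc k (q ^ d) m ⟩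
          k + (q ^ d + m)          ≡⟨ cong (k +_) (ℕ.+-comm (q ^ d) m) ⟩
          k + (m + q ^ d)          ≡⟨ cong (k +_) (#-own-class i x ≡.refl) ⟨
          _                        ≡⟨ Points.#-⊻ (in? i) (_∈ˢ? (x ^ζ)) ⟩
          _                        ≡⟨ cong₂ _+_ (#-class i) (#-class-complement i x ≡.refl) ⟩
          M * G e + m              ∎) ⟩
        M * G e                  ∎)
        where
        open ≡.≡-Reasoning
        i = cl x
        m = M * G d
        adjacent? : Decidable (λ z → (cl z ≡ i) ⊻ (z ∈ˢ x ^ζ))
        adjacent? z = in? i z ⊻-dec z ∈ˢ? (x ^ζ)
        k = Points.# adjacent?

      ~-∩-resp : ∀ x y {z w} → z ≈ₚ w → x ~ z × y ~ z → x ~ w × y ~ w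
      ~-∩-resp x y {z} {w} z≈w (x~z , y~z) =
        proj₁ ~-resp {x} {z} {w} z≈w x~z , proj₁ ~-resp {y} {z} {w} z≈w y~z

      #-^ζ-∩ : ∀ x y → ¬ x ≈ₚ y →
        Points.# (λ z → z ∈ˢ? (x ^ζ) ×-dec z ∈ˢ? (y ^ζ)) ≡ G (2 * d)
      #-^ζ-∩ x y x≉y = ≡.trans
        (Points.#-cong (λ z → z ∈ˢ? (x ^ζ) ×-dec z ∈ˢ? (y ^ζ)) (_∈ˢ? (x ^ζ ⊓ y ^ζ)) λ z →
          mk⇔ (λ (z∈x , z∈y) {u} u∈z → z∈x u∈z , z∈y u∈z)
              (λ z∈ → (λ {u} u∈z → proj₁ (z∈ u∈z)) , (λ {u} u∈z → proj₂ (z∈ u∈z))))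
        (pointsOf-^ζ-⊓ x y x≉y)

      -- Both polars meet the common class in m + Q points. By `balance`, 2(m + Q) = g + Q² + Q, and
      -- g is also the size of x^ζ ∩ y^ζ, so it cancels.
      common-same : ∀ x y → ¬ x ≈ₚ y → cl x ≡ cl y →
        ∃[ l ] HasSize (subsetoid points ((x ~_) ∩ (y ~_))) l × l + (q ^ (2 * d) + q ^ d) ≡ M * G e
      common-same x y x≉y x≡y = _ , Points.#-hasSize-⇔ (~-∩-resp x y) common? (λ z → x~⇔ z ×-⇔ y~⇔ z) ,
        ℕ.+-cancelʳ-≡ (G (2 * d)) _ _ (begin
          l + (Q² + Q) + g         ≡⟨ ℕ.+-assoc l (Q² + Q) g ⟩
          l + (Q² + Q + g)         ≡⟨ cong (l +_) regroup ⟩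
          l + (m + Q + (m + Q))    ≡⟨ cong (l +_) (cong₂ _+_ (#-own-class i x ≡.refl)
                                                             (#-own-class i y (≡.sym x≡y))) ⟨
          _                        ≡⟨ Points.#-⊻-⊻ (in? i) (_∈ˢ? (x ^ζ)) (_∈ˢ? (y ^ζ)) ⟩
          _                        ≡⟨ cong₂ _+_ (#-class i) (#-^ζ-∩ x y x≉y) ⟩
          M * G e + g              ∎)
        where
        open ≡.≡-Reasoning
        i = cl x
        m = M * G d
        Q = q ^ d
        Q² = q ^ (2 * d)
        g = G (2 * d)
        regroup : Q² + Q + g ≡ m + Q + (m + Q)
        regroup = begin
          Q² + Q + g       ≡⟨ ℕ.+-comm (Q² + Q) g ⟩
          g + (Q² + Q)     ≡⟨ ℕ.+-assoc g Q² Q ⟨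
          g + Q² + Q       ≡⟨ cong (_+ Q) (balance x) ⟨
          m + m + Q + Q    ≡⟨ ℕ.+-assoc (m + m) Q Q ⟩
          m + m + (Q + Q)  ≡⟨ interchange m m Q Q ⟩
          m + Q + (m + Q)  ∎
          where open CommutativeSemigroupProperties ℕ.+-commutativeSemigroup using (interchange)
        x~⇔ : ∀ z → x ~ z ⇔ (cl z ≡ i) ⊻ (z ∈ˢ x ^ζ)
        x~⇔ z = ~⇔⊻ x z sym⇔
        y~⇔ : ∀ z → y ~ z ⇔ (cl z ≡ i) ⊻ (z ∈ˢ y ^ζ)
        y~⇔ z = ~⇔⊻ y z (mk⇔ (λ eq → ≡.sym (≡.trans x≡y eq)) (λ eq → ≡.trans (≡.sym x≡y) (≡.sym eq)))
        common? : Decidable (λ z → ((cl z ≡ i) ⊻ (z ∈ˢ x ^ζ)) × ((cl z ≡ i) ⊻ (z ∈ˢ y ^ζ)))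
        common? z = (in? i z ⊻-dec z ∈ˢ? (x ^ζ)) ×-dec (in? i z ⊻-dec z ∈ˢ? (y ^ζ))
        l = Points.# common?

      -- Each polar has m points in the class of the other vertex, so the identity gives l + g = 2m;
      -- adding Q and applying `balance` leaves l + Q = Q².
      common-distinct : ∀ x y → cl x ≢ cl y →
        ∃[ l ] HasSize (subsetoid points ((x ~_) ∩ (y ~_))) l × l + q ^ d ≡ q ^ (2 * d)
      common-distinct x y x≢y = _ , Points.#-hasSize-⇔ (~-∩-resp x y) common? (λ z → x~⇔ z ×-⇔ y~⇔ z) ,
        ℕ.+-cancelˡ-≡ g _ _ (begin
          g + (l + Q)    ≡⟨ ℕ.+-assoc g l Q ⟨
          g + l + Q      ≡⟨ cong (_+ Q) (ℕ.+-comm g l) ⟩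
          l + g + Q      ≡⟨ cong (λ k → l + k + Q) (#-^ζ-∩ x y (x≢y ∘ Func.cong V)) ⟨
          _              ≡⟨ cong (_+ Q) (Points.#-⊻-⊻¬ (in? i) (_∈ˢ? (x ^ζ)) (_∈ˢ? (y ^ζ))) ⟩
          _              ≡⟨ cong (_+ Q) (cong₂ _+_ (#-other-class i y (x≢y ∘ ≡.sym))
                                                   (#-class-complement i x ≡.refl)) ⟩
          m + m + Q      ≡⟨ balance x ⟩
          g + Q²         ∎)
        where
        open ≡.≡-Reasoning
        i = cl x
        m = M * G d
        Q = q ^ d
        Q² = q ^ (2 * d)
        g = G (2 * d)
        x~⇔ : ∀ z → x ~ z ⇔ (cl z ≡ i) ⊻ (z ∈ˢ x ^ζ)
        x~⇔ z = ~⇔⊻ x z sym⇔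
        -- With only two classes, that of y is the complement of class i, so both adjacencies can be
        -- expressed through one set.
        y-class : ∀ z → (cl y ≡ cl z) ⇔ (¬ cl z ≡ i)
        y-class z = mk⇔ (λ y≡z z≡x → x≢y (≡.sym (≡.trans y≡z z≡x)))
          (λ z≢x → ≡.trans (Equivalence.to (≢⇔≡opposite i (cl y)) x≢y)
                     (≡.sym (Equivalence.to (≢⇔≡opposite i (cl z)) (z≢x ∘ ≡.sym))))
        y~⇔ : ∀ z → y ~ z ⇔ (¬ cl z ≡ i) ⊻ (z ∈ˢ y ^ζ)
        y~⇔ z = ~⇔⊻ y z (y-class z)
        common? : Decidable (λ z → ((cl z ≡ i) ⊻ (z ∈ˢ x ^ζ)) × ((¬ cl z ≡ i) ⊻ (z ∈ˢ y ^ζ)))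
        common? z = (in? i z ⊻-dec z ∈ˢ? (x ^ζ)) ×-dec (¬? (in? i z) ⊻-dec z ∈ˢ? (y ^ζ))
        l = Points.# common?

      -- The parameters of the design

      points-geometricSum : HasSize points (G N)
      points-geometricSum = ≡.subst (HasSize points) (≡.trans
        (≡.sym (Points.all-# (_∈ˢ? fullSpace) (λ x {u} _ → _)))
        (pointsOf-dim fullSpace N fullSpace-hasSize)) points-hasSize

      class-hasSize : ∀ i → HasSize (subsetoid points (Class V i)) (M * G e)
      class-hasSize i = ≡.subst (HasSize (subsetoid points (Class V i))) (#-class i)
        (Points.#-hasSize (λ x≈y x∈i → ≡.trans (≡.sym (Func.cong V x≈y)) x∈i) (in? i))

      two-classes : M * G e * 2 ≡ G N
      two-classes = begin
        n * 2          ≡⟨ ℕ.*-comm n 2 ⟩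
        n + (n + 0)    ≡⟨ cong (n +_) (ℕ.+-identityʳ n) ⟩
        n + n          ≡⟨ cong₂ _+_ (#-class zero) (≡.trans (Points.#-cong (λ z → ¬? (in? zero z)) (in? (suc zero))
                            λ z → mk⇔ (λ z∉0 → Equivalence.to (≢⇔≡opposite zero (cl z)) (z∉0 ∘ ≡.sym))
                                      (λ z∈1 → Equivalence.from (≢⇔≡opposite zero (cl z)) z∈1 ∘ ≡.sym))
                            (#-class (suc zero))) ⟨
        _              ≡⟨ Points.#-complement (in? zero) ⟩
        _              ≡⟨ hasSize-unique points-hasSize points-geometricSum ⟩
        G N            ∎
        where
        open ≡.≡-Reasoning
        n = M * G e

      v : ℕ
      v = (q ^ N ∸ 1) / t

      v≡ : v ≡ G N
      v≡ = begin
        (q ^ N ∸ 1) / t        ≡⟨ cong (λ k → (k ∸ 1) / t) (geometricSum-closed t N) ⟨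
        (G N * t + 1 ∸ 1) / t  ≡⟨ cong (_/ t) (ℕ.m+n∸n≡m (G N * t) 1) ⟩
        G N * t / t            ≡⟨ m*n/n≡m (G N) t ⟩
        G N                    ∎
        where open ≡.≡-Reasoning

      v/2≡ : v / 2 ≡ M * G e
      v/2≡ = ≡.trans (cong (_/ 2) (≡.trans v≡ (≡.sym two-classes))) (m*n/n≡m (M * G e) 2)

      private
        resize : ∀ {S : Setoid a ℓ} {n} → ∃[ m ] HasSize S m × m ≡ n → HasSize S n
        resize (_ , h , ≡.refl) = h

        -- The additive equation guarantees n ≤ k, so the subtractions in k, λ₁ and λ₂ do not
        -- truncate.
        solve-∸ : ∀ {m n k} → m + n ≡ k → m ≡ k ∸ n
        solve-∸ {m} {n} eq = ≡.trans (≡.sym (ℕ.m+n∸n≡m m n)) (cong (_∸ n) eq)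

      isDivisibleDesignGraph : IsDivisibleDesignGraph Γ′ v (v / 2 ∸ q ^ d)
        (v / 2 ∸ q ^ (2 * e ∸ 2) ∸ q ^ d) (q ^ (2 * e ∸ 2) ∸ q ^ d) 2 (v / 2)
      isDivisibleDesignGraph = record
        { order          = ≡.subst (HasSize points) (≡.sym v≡) points-geometricSum
        ; regular        = λ x → resize (Product.map₂ (Product.map₂ λ eq →
            ≡.trans (solve-∸ eq) (cong (_∸ q ^ d) (≡.sym v/2≡))) (degree x))
        ; partition      = V
        ; class-size     = λ i → ≡.subst (HasSize (subsetoid points (Class V i))) (≡.sym v/2≡)
            (class-hasSize i)
        ; same-class     = λ {x} {y} x≉y x≡y → resize (Product.map₂ (Product.map₂ λ eq →
            ≡.trans (solve-∸ eq) (≡.trans (≡.sym (ℕ.∸-+-assoc (M * G e) (q ^ (2 * d)) (q ^ d)))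
              (cong₂ (λ n k → n ∸ q ^ k ∸ q ^ d) (≡.sym v/2≡) 2d≡)))
            (common-same x y x≉y x≡y))
        ; distinct-class = λ {x} {y} x≢y → resize (Product.map₂ (Product.map₂ λ eq →
            ≡.trans (solve-∸ eq) (cong (λ k → q ^ k ∸ q ^ d) 2d≡))
            (common-distinct x y x≢y))
        }
        where
        2d≡ : 2 * d ≡ 2 * e ∸ 2
        2d≡ = cong (_∸ 1) (≡.sym 2d+1)

theorem7 : ∀ {c ℓ₁ ℓ₂ r : Level} (q e : ℕ) (q-opp : OddPrimePower q) → 2 ≤ e →
    (F : HeytingField c ℓ₁ ℓ₂) → HasSize (HeytingField-setoid F) q →
    let open PG F (2 * e) in
    (Z : SymplecticPolarity) →
    (R : Pred Subspace r) → IsSymplecticSpread Z e R →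
    (V : Partition points 2) →
    (∃[ s ] (∀ i → HasSize (subsetoid points (Class V i)) s)) →
    (∀ i → IsUnionOf ((q ^ e + 1) / 2) R (Class V i)) →
    let instance _ = q∸1-nonZero q-opp
        v = (q ^ (2 * e) ∸ 1) / (q ∸ 1)
    in
    IsDivisibleDesignGraph (complementWithinClasses (symplecticGraph Z) V)
      v
      (v / 2 ∸ q ^ (e ∸ 1))
      (v / 2 ∸ q ^ (2 * e ∸ 2) ∸ q ^ (e ∸ 1))
      (q ^ (2 * e ∸ 2) ∸ q ^ (e ∸ 1))
      2
      (v / 2)
theorem7 zero e q-opp _ = contradiction (2 ∣0) (OddPrimePower.odd q-opp)
-- Writing q as `suc t` and e as `suc d` lets `q ∸ 1` and `e ∸ 1` compute to t and d, so the result
-- of the module has the required type without rewriting.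
theorem7 (suc t) (suc d) q-opp _ F hF Z R spread V _ union =
  Spreads.Spread.Bipartition.isDivisibleDesignGraph F {{q∸1-nonZero q-opp}} hF d Z spread V union
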